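{- Let $n\ge1$. (1) d-Transformations convert a digital $n$-manifold into a digital $n$-manifold. (2) d-Transformations convert a digital $n$-sphere into a digital $n$-sphere. (3) A digital $n$-manifold $M$ is a digital $n$-sphere if and only if $M$ is equivalent to the minimal $n$-sphere $S^n_{min}$. (4) A digital $n$-manifold $M$ is a digital $n$-sphere if and only if there is a point $v$ of $M$ such that $M-v$ is a digital $n$-disk.
   Context: A digital space is a finite simple undirected graph, its vertices are called points; a subspace is an induced subgraph. $M-v$ denotes the subspace obtained by deleting the point $v$. For a point $v$, the rim $O(v)$ is the subspace induced on the neighbours of $v$; $O(v,u)=O(v)\cap O(u)$. The family $T$ of contractible graphs is defined inductively: the one-point graph $K(1)$ belongs to $T$, and $T$ consists of all graphs obtained from $K(1)$ by finite sequences of the following contractible transformations: deleting a point $v$ with $O(v)\in T$; adding a new point $v$ so that its rim is an induced subgraph $H\in T$; deleting an edge $(v,u)$ with $O(v,u)\in T$; adding an edge between non-adjacent points $v,u$ with $O(v,u)\in T$. A digital $0$-disk is a single point; a digital $0$-sphere is the graph consisting of two non-adjacent points. A digital $1$-sphere is a connected graph in which the rim of every point is a $0$-sphere; a digital $1$-disk is a $1$-sphere with one point deleted (its boundary is the pair of endpoints, its interior the remaining points). Recursively for $n\ge2$: a digital $n$-disk is a connected contractible graph $D$ that is a disjoint union $D=\partial D\cup\mathrm{Int}D$ of two nonempty subspaces such that the rim (in $D$) of each point of $\partial D$ is a digital $(n-1)$-disk, the rim of each point of $\mathrm{Int}D$ is a digital $(n-1)$-sphere, and the boundary $\partial D$ is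 a digital $(n-1)$-sphere; a digital $n$-sphere is a graph $D\#C$ obtained from two digital $n$-disks $D,C$ with isomorphic boundaries by identifying each point of $\partial D$ with its counterpart in $\partial C$. A digital $n$-manifold is a connected graph in which the rim of every point is a digital $(n-1)$-sphere. The join $G\oplus H$ of two disjoint graphs consists of $G$, $H$ and all edges between points of $G$ and points of $H$. The minimal $n$-sphere is $S^n_{min}=S^0_1\oplus\dots\oplus S^0_{n+1}$, the join of $n+1$ copies of the $0$-sphere. d-Transformations of an $n$-manifold $N$: (i) if $D$ is a digital $n$-disk belonging to $N$ (an induced subgraph) and $v\in\mathrm{Int}D$, delete all points of $\mathrm{Int}D$ except $v$ and join $v$ to every point of $\partial D$; (ii) if $v$ is a point of $N$ and $D$ is a digital $n$-disk disjoint from $N$ with $\partial D$ isomorphic to $O(v)$, identify each point of $\partial D$ with its counterpart in $O(v)$ and delete $v$. Two $n$-manifolds are equivalent if one can be obtained from the other by a sequence of d-transformations. -}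

module Defs where

open import Data.Empty using () renaming (⊥ to Empty)
open import Data.Fin using (Fin; zero; suc; splitAt; _↑ˡ_)
open import Data.Fin.Properties using (any?) renaming (_≟_ to _≟ᶠ_)
open import Data.Fin.Subset
  using (Subset; inside; outside; _∈_; _∉_; ∁; _∩_; _∪_; ⁅_⁆; ∣_∣; Nonempty)
  renaming (Empty to EmptySubset)
open import Data.Fin.Subset.Properties using (_∈?_)
open import Data.Nat using (ℕ; zero; suc; _+_; NonZero)
open import Data.Product using (∃; ∃-syntax; _×_; _,_)
open import Data.Sum using (_⊎_; inj₁; inj₂; map; swap; [_,_]′)
open import Data.Unit using (⊤; tt)
open import Data.Vec using (tabulate; []; _∷_)
open import Data.Vec.Properties using (lookup∘tabulate; []=⇒lookup; lookup⇒[]=)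
open import Function using (_↔_; _⇔_; Inverse; _∘_)
open import Relation.Binary.Construct.Closure.ReflexiveTransitive using (Star)
open import Relation.Binary.Construct.Union using () renaming (_∪_ to _∪ᴿ_)
open import Relation.Binary.PropositionalEquality
  using (_≡_; _≢_; refl; sym; trans; subst)
open import Relation.Nullary using (¬_; Dec; yes; no; does; ¬?)
open import Relation.Nullary.Decidable using (_×-dec_; _⊎-dec_; dec-true)

-- O v is the set of neighbours of v, so that "u ∈ O v" is adjacency.
record Graph : Set where
  field
    order    : ℕ
    O        : Fin order → Subset order
    O-sym    : ∀ {v u} → u ∈ O v → v ∈ O u
    O-irrefl : ∀ {v} → v ∉ O v

  Point : Set
  Point = Fin order

  Adjacent : Point → Point → Set
  Adjacent v u = u ∈ O v

open Graph public

module _ {n} {R : Fin n → Fin n → Set} (R? : ∀ v u → Dec (R v u)) where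

  nbrs : Fin n → Subset n
  nbrs v = tabulate (λ u → does (R? v u))

  fromNbrs : ∀ {v u} → u ∈ nbrs v → R v u
  fromNbrs {v} {u} u∈ = go (R? v u)
      (trans (sym (lookup∘tabulate (λ w → does (R? v w)) u)) ([]=⇒lookup u∈))
    where
    go : (d : Dec (R v u)) → does d ≡ inside → R v u
    go (yes r) _ = r

  toNbrs : ∀ {v u} → R v u → u ∈ nbrs v
  toNbrs {v} {u} r = lookup⇒[]= u (nbrs v)
    (trans (lookup∘tabulate (λ w → does (R? v w)) u) (dec-true (R? v u) r))

  graphOf : (∀ {v u} → R v u → R u v) → (∀ {v} → ¬ R v v) → Graph
  graphOf R-sym R-irrefl = record
    { order    = n
    ; O        = nbrs
    ; O-sym    = toNbrs ∘ R-sym ∘ fromNbrs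
    ; O-irrefl = R-irrefl ∘ fromNbrs
    }

infix 4 _≅_

record _≅_ (G H : Graph) : Set where
  field
    bijection : Point G ↔ Point H

  to : Point G → Point H
  to = Inverse.to bijection

  field
    adjacency : ∀ v u → Adjacent G v u ⇔ Adjacent H (to v) (to u)

-- The points of a subset p of Fin n, listed in increasing order.
embed : ∀ {n} (p : Subset n) → Fin ∣ p ∣ → Fin n
embed (inside  ∷ p) zero    = zero
embed (inside  ∷ p) (suc i) = suc (embed p i)
embed (outside ∷ p) i       = suc (embed p i)

-- The image of a subset of Fin ∣ p ∣ under embed p.
image : ∀ {n} (p : Subset n) → Subset ∣ p ∣ → Subset n
image []            _       = []
image (inside  ∷ p) (s ∷ q) = s ∷ image p q
image (outside ∷ p) q       = outside ∷ image p q

induced : (G : Graph) → Subset (order G) → Graph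
induced G p = graphOf (λ i j → embed p j ∈? O G (embed p i)) (O-sym G) (O-irrefl G)

infixl 6 _-_

_-_ : (G : Graph) → Point G → Graph
G - v = induced G (∁ ⁅ v ⁆)

rim : (G : Graph) → Point G → Graph
rim G v = induced G (O G v)

commonRim : (G : Graph) → Point G → Point G → Graph
commonRim G v u = induced G (O G v ∩ O G u)

-- The empty graph does not count as connected.
Connected : Graph → Set
Connected G = NonZero (order G) × (∀ v u → Star (Adjacent G) v u)

Cross : (G H : Graph) → (Point G → Point H → Set) →
        (Point G ⊎ Point H) → (Point G ⊎ Point H) → Set
Cross G H R (inj₁ x) (inj₁ y) = Adjacent G x y
Cross G H R (inj₂ x) (inj₂ y) = Adjacent H x y
Cross G H R (inj₁ x) (inj₂ y) = R x y
Cross G H R (inj₂ x) (inj₁ y) = R y x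

module _ (G H : Graph) {R : Point G → Point H → Set} where

  Cross? : (∀ x y → Dec (R x y)) → ∀ a b → Dec (Cross G H R a b)
  Cross? R? (inj₁ x) (inj₁ y) = y ∈? O G x
  Cross? R? (inj₂ x) (inj₂ y) = y ∈? O H x
  Cross? R? (inj₁ x) (inj₂ y) = R? x y
  Cross? R? (inj₂ x) (inj₁ y) = R? y x

  Cross-sym : ∀ a b → Cross G H R a b → Cross G H R b a
  Cross-sym (inj₁ x) (inj₁ y) r = O-sym G r
  Cross-sym (inj₂ x) (inj₂ y) r = O-sym H r
  Cross-sym (inj₁ x) (inj₂ y) r = r
  Cross-sym (inj₂ x) (inj₁ y) r = r

  Cross-irrefl : ∀ a → ¬ Cross G H R a a
  Cross-irrefl (inj₁ x) = O-irrefl G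
  Cross-irrefl (inj₂ x) = O-irrefl H

-- The disjoint union of G and H together with an edge between x in G and
-- y in H whenever R x y.
linked : (G H : Graph) {R : Point G → Point H → Set} →
         (∀ x y → Dec (R x y)) → Graph
linked G H R? = graphOf
  (λ v u → Cross? G H R? (splitAt (order G) v) (splitAt (order G) u))
  (λ {v} {u} → Cross-sym G H (splitAt (order G) v) (splitAt (order G) u))
  (λ {v} → Cross-irrefl G H (splitAt (order G) v))

edgeless : ℕ → Graph
edgeless n = graphOf {n} {λ _ _ → Empty} (λ _ _ → no λ ()) (λ ()) (λ ())

K₁ : Graph
K₁ = edgeless 1

S⁰ : Graph
S⁰ = edgeless 2

infixr 5 _⊕_

_⊕_ : Graph → Graph → Graph
G ⊕ H = linked G H {λ _ _ → ⊤} (λ _ _ → yes tt)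

minimalSphere : ℕ → Graph
minimalSphere zero    = S⁰
minimalSphere (suc n) = S⁰ ⊕ minimalSphere n

addPoint : (G : Graph) → Subset (order G) → Graph
addPoint G p = linked K₁ G {λ _ x → x ∈ p} (λ _ x → x ∈? p)

-- Each point of p in G is identified with its counterpart under φ in H: the
-- points are those of G and those of H outside q, and a point of p also
-- acquires the neighbours outside q of its counterpart.
glue : (G : Graph) (p : Subset (order G)) (H : Graph) (q : Subset (order H)) →
       induced G p ≅ induced H q → Graph
glue G p H q φ = linked G (induced H (∁ q))
  {λ x y → ∃[ i ] embed p i ≡ x × Adjacent H (embed q (_≅_.to φ i)) (embed (∁ q) y)}
  (λ x y → any? λ i →
     (embed p i ≟ᶠ x) ×-dec (embed (∁ q) y ∈? O H (embed q (_≅_.to φ i))))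

-- No loop is created at v, even if v ∈ p.
joinTo : (G : Graph) → Point G → Subset (order G) → Graph
joinTo G v p = graphOf
  (λ x y → (y ∈? O G x) ⊎-dec
     (¬? (x ≟ᶠ y) ×-dec (((x ≟ᶠ v) ×-dec (y ∈? p)) ⊎-dec ((y ≟ᶠ v) ×-dec (x ∈? p)))))
  (map (O-sym G) λ (x≢y , r) → (λ e → x≢y (sym e)) , swap r)
  [ O-irrefl G , (λ (x≢x , _) → x≢x refl) ]′

addEdge : (G : Graph) → Point G → Point G → Graph
addEdge G v u = joinTo G v ⁅ u ⁆

deleteEdge : (G : Graph) → Point G → Point G → Graph
deleteEdge G v u = graphOf
  (λ x y → (y ∈? O G x) ×-dec
     ¬? (((x ≟ᶠ v) ×-dec (y ≟ᶠ u)) ⊎-dec ((x ≟ᶠ u) ×-dec (y ≟ᶠ v))))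
  (λ (xy , ≢e) → O-sym G xy ,
     λ { (inj₁ (y≡v , x≡u)) → ≢e (inj₂ (x≡u , y≡v))
       ; (inj₂ (y≡u , x≡v)) → ≢e (inj₁ (x≡v , y≡u)) })
  (λ (xx , _) → O-irrefl G xx)

data Contractible : Graph → Set where
  single      : Contractible K₁
  relabel     : ∀ {G H} → G ≅ H → Contractible G → Contractible H
  pointDelete : ∀ {G} (v : Point G) → Contractible (rim G v) →
                Contractible G → Contractible (G - v)
  pointAdd    : ∀ {G} (p : Subset (order G)) → Contractible (induced G p) →
                Contractible G → Contractible (addPoint G p)
  edgeDelete  : ∀ {G} (v u : Point G) → Adjacent G v u →
                Contractible (commonRim G v u) →
                Contractible G → Contractible (deleteEdge G v u)
  edgeAdd     : ∀ {G} (v u : Point G) → v ≢ u → ¬ Adjacent G v u →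
                Contractible (commonRim G v u) →
                Contractible G → Contractible (addEdge G v u)

Is0Disk : Graph → Set
Is0Disk G = G ≅ K₁

Is0Sphere : Graph → Set
Is0Sphere G = G ≅ S⁰

Is1Sphere : Graph → Set
Is1Sphere G = Connected G × (∀ v → Is0Sphere (rim G v))

-- b is the set of end points, i.e. of the points with exactly one neighbour.
record Is1Disk (D : Graph) (b : Subset (order D)) : Set where
  field
    sphere     : Graph
    is1Sphere  : Is1Sphere sphere
    deleted    : Point sphere
    iso        : D ≅ sphere - deleted
    isBoundary : ∀ x → x ∈ b ⇔ Is0Disk (rim D x)

-- D is an n-disk with boundary b and interior ∁ b, where Sphere and Disk are
-- the (n-1)-spheres and the (n-1)-disks.
record DiskStep (Sphere Disk : Graph → Set)
                (D : Graph) (b : Subset (order D)) : Set where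
  field
    connected         : Connected D
    contractible      : Contractible D
    boundary-nonempty : Nonempty b
    interior-nonempty : Nonempty (∁ b)
    boundary-rim      : ∀ x → x ∈ b → Disk (rim D x)
    interior-rim      : ∀ x → x ∈ ∁ b → Sphere (rim D x)
    boundary-sphere   : Sphere (induced D b)

-- G is D # C for some D and C, where Disk D b says that D is an n-disk with
-- boundary b.
record SphereStep (Disk : (D : Graph) → Subset (order D) → Set)
                  (G : Graph) : Set where
  field
    D C       : Graph
    ∂D        : Subset (order D)
    ∂C        : Subset (order C)
    D-disk    : Disk D ∂D
    C-disk    : Disk C ∂C
    ∂D≅∂C     : induced D ∂D ≅ induced C ∂C
    iso       : G ≅ glue D ∂D C ∂C ∂D≅∂C

-- The boundary of the 0-disk is taken to be empty.
mutual
  IsDiskWithBoundary : ℕ → (D : Graph) → Subset (order D) → Set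
  IsDiskWithBoundary zero          D b = Is0Disk D × EmptySubset b
  IsDiskWithBoundary (suc zero)    D b = Is1Disk D b
  IsDiskWithBoundary (suc (suc n)) D b =
    DiskStep (IsSphere (suc n)) (λ G → ∃ (IsDiskWithBoundary (suc n) G)) D b

  IsSphere : ℕ → Graph → Set
  IsSphere zero          G = Is0Sphere G
  IsSphere (suc zero)    G = Is1Sphere G
  IsSphere (suc (suc n)) G = SphereStep (IsDiskWithBoundary (suc (suc n))) G

IsDisk : ℕ → Graph → Set
IsDisk n D = ∃ (IsDiskWithBoundary n D)

IsManifold : (n : ℕ) .{{_ : NonZero n}} → Graph → Set
IsManifold (suc n) G = Connected G × (∀ v → IsSphere n (rim G v))

-- D is the subspace on p, with boundary b and interior ∁ b (subsets of the
-- points of D); v is a point of D.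
replaceDisk : (N : Graph) (p : Subset (order N)) → Subset ∣ p ∣ → Fin ∣ p ∣ → Graph
replaceDisk N p b v =
  induced (joinTo N (embed p v) (image p b)) (∁ (image p (∁ b)) ∪ ⁅ embed p v ⁆)

replacePoint : (N : Graph) (v : Point N) (D : Graph) (b : Subset (order D)) →
               rim N v ≅ induced D b → Graph
replacePoint N v D b φ = glue N (O N v) D b φ - (v ↑ˡ ∣ ∁ b ∣)

data DTransformation (n : ℕ) (N N′ : Graph) : Set where
  disk→point : (p : Subset (order N)) (b : Subset ∣ p ∣) →
               IsDiskWithBoundary n (induced N p) b →
               (v : Fin ∣ p ∣) → v ∈ ∁ b →
               N′ ≅ replaceDisk N p b v → DTransformation n N N′
  point→disk : (v : Point N) (D : Graph) (b : Subset (order D)) →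
               IsDiskWithBoundary n D b → (φ : rim N v ≅ induced D b) →
               N′ ≅ replacePoint N v D b φ → DTransformation n N N′

-- N results from M by a (possibly empty) sequence of d-transformations, where
-- isomorphic graphs are not distinguished.
Obtainable : ℕ → Graph → Graph → Set
Obtainable n = Star (DTransformation n ∪ᴿ _≅_)

Equivalent : ℕ → Graph → Graph → Set
Equivalent n M N = Obtainable n M N ⊎ Obtainable n N M

{-# OPTIONS --safe #-}

-- Everything takes place among the subspaces of a fixed finite graph. A manifold
-- is a sphere exactly when it becomes contractible on deleting a point, and then
-- it does so on deleting any point: for adjacent x and y the rim of x in P ∖ y is
-- a punctured sphere of lower dimension, hence contractible, so that P ∖ x and
-- P ∖ y are both contractible if P without x and y is.
--
-- Both d-transformations are cases of the following exchange. Let B ∪ I and B ∪ J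
-- be disks with boundary B, and let no point of A be adjacent to I or J. If
-- A ∪ B ∪ I is a sphere (manifold), so is A ∪ B ∪ J: at a point of B the rims are
-- again related by an exchange, and contractibility passes over because I can be
-- deleted and J added in the presence of a cone over B ∪ I ∪ J.
--
-- A sphere M shrinks to the suspension of the rim of any of its points, by
-- contracting the complement of that point. As d-transformations can be suspended,
-- induction leads to the minimal sphere.

module Submission where

open import Defs
open import Data.Empty using (⊥; ⊥-elim)
open import Data.Fin using (Fin; zero; suc; splitAt; _↑ˡ_; join)
open import Data.Fin.Properties using (any?; suc-injective; splitAt-join; join-splitAt; splitAt-↑ˡ; splitAt⁻¹-↑ˡ)
  renaming (_≟_ to _≟ᶠ_)
open import Data.Fin.Subset as Subset using (Subset; inside; outside; ∁; ⁅_⁆; ∣_∣)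
open import Data.Fin.Subset.Properties as Subset
  using (_∈?_; x∈∁p⇒x∉p; x∉p⇒x∈∁p; x∈⁅x⁆; x∈⁅y⁆⇒x≡y; x∈p∪q⁻; x∈p∪q⁺)
open import Data.List using (List; []; _∷_; length; filter; allFin; _++_) renaming (map to mapᴸ)
open import Data.List.Membership.Propositional using () renaming (_∈_ to _∈ᴸ_)
open import Data.List.Membership.Propositional.Properties
  using (∈-allFin; ∈-map⁺; ∈-++⁺ˡ; ∈-++⁺ʳ; ∈-filter⁺)
open import Data.List.Properties using (filter-notAll)
open import Data.List.Relation.Unary.Any as Any using (here; there)
open import Data.Maybe using (Maybe; just; nothing)
open import Data.Maybe.Properties using () renaming (≡-dec to ≡-decᴹ)
open import Data.Nat using (ℕ; zero; suc; NonZero; _≤_; _<_)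
open import Data.Nat.Properties using (≤-trans; ≤-pred; ≤-refl)
open import Data.Product using (∃; ∃-syntax; _×_; _,_; proj₁; proj₂; map₂; swap)
open import Data.Sum using (_⊎_; inj₁; inj₂; [_,_]′) renaming (map to map⊎)
open import Data.Sum.Properties using (inj₂-injective) renaming (≡-dec to ≡-dec⊎)
open import Data.Unit using (⊤; tt)
open import Data.Vec using (tabulate; []; _∷_; here; there)
open import Data.Vec.Properties using (lookup∘tabulate; []=⇒lookup; lookup⇒[]=)
open import Function using (_∘_; _⇔_; mk⇔; mk↔ₛ′; id; Equivalence; Inverse)
open import Relation.Binary.Construct.Closure.ReflexiveTransitive as Star using (Star; ε; _◅_; _◅◅_)
open import Relation.Binary.Construct.Union using () renaming (_∪_ to _∪ᴿ_)
open import Relation.Binary.PropositionalEquality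
  using (_≡_; _≢_; refl; sym; trans; cong; subst; subst₂; ≢-sym)
open import Relation.Nullary using (¬_; Dec; yes; no; does; ¬?)
open import Relation.Nullary.Decidable using (_×-dec_; _⊎-dec_; map′; dec-true)
open import Relation.Unary using (Pred; U; ｛_｝; _⊆_; _≐_; _∪_; Decidable)
open import Level using (0ℓ)

open Equivalence using () renaming (to to ⇒; from to ⇐)

-- Two rigidity facts make the exchange applicable. A sphere contains no smaller sphere of the same
-- dimension (`sub-sphere`): hence the interior of a disk inside a manifold has no neighbours
-- outside the disk, which is the separation of `A` from `I`. A sphere is not a disk
-- (`sphere-not-disk`): hence `A` has a point, and the puncture can be made there, away from
-- everything that is exchanged. The definitions raise two obstacles. The rim of a boundary point of
-- a disk is only asked to be some disk, while the inductions need its boundary to be the part of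
-- the rim that lies in the given boundary; `rim-disk` shows that there is no other choice. And a
-- 1-sphere comes without any contractible piece, so in dimension one contractibility has to be
-- built along the circle; in higher dimensions the glued disks bring it along. The exchange is
-- symmetric in `I` and `J`. Thus being a sphere also passes backwards along d-transformations, as
-- the equivalence with the minimal sphere demands.

module _ {n} {P : Pred (Fin n) 0ℓ} (P? : Decidable P) where

  select : Subset n
  select = tabulate (does ∘ P?)

  select⁻ : ∀ {i} → i Subset.∈ select → P i
  select⁻ {i} i∈ with P? i | trans (sym (lookup∘tabulate (does ∘ P?) i)) ([]=⇒lookup i∈)
  ... | yes p | _ = p

  select⁺ : ∀ {i} → P i → i Subset.∈ select
  select⁺ {i} p =
    lookup⇒[]= i select (trans (lookup∘tabulate (does ∘ P?) i) (dec-true (P? i) p))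

nbrs-⇔ : ∀ {n} {R : Fin n → Fin n → Set} (R? : ∀ v u → Dec (R v u)) v u →
         u Subset.∈ nbrs R? v ⇔ R v u
nbrs-⇔ R? v u = mk⇔ (fromNbrs R? {v} {u}) (toNbrs R? {v} {u})

embed-∈ : ∀ {n} (p : Subset n) i → embed p i Subset.∈ p
embed-∈ (inside  ∷ p) zero    = here
embed-∈ (inside  ∷ p) (suc i) = there (embed-∈ p i)
embed-∈ (outside ∷ p) i       = there (embed-∈ p i)

embed-surjective : ∀ {n} (p : Subset n) {x} → x Subset.∈ p → ∃[ i ] embed p i ≡ x
embed-surjective (inside  ∷ p) here       = zero , refl
embed-surjective (inside  ∷ p) (there x∈) =
  let i , e = embed-surjective p x∈ in suc i , cong suc e
embed-surjective (outside ∷ p) (there x∈) =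
  let i , e = embed-surjective p x∈ in i , cong suc e

embed-injective : ∀ {n} (p : Subset n) {i j} → embed p i ≡ embed p j → i ≡ j
embed-injective (inside  ∷ p) {zero}  {zero}  _ = refl
embed-injective (inside  ∷ p) {suc i} {suc j} e = cong suc (embed-injective p (suc-injective e))
embed-injective (outside ∷ p) e = embed-injective p (suc-injective e)

image⁺ : ∀ {n} (p : Subset n) {q : Subset ∣ p ∣} {i} → i Subset.∈ q → embed p i Subset.∈ image p q
image⁺ (inside  ∷ p) {s ∷ q} {zero}  here      = here
image⁺ (inside  ∷ p) {s ∷ q} {suc i} (there m) = there (image⁺ p m)
image⁺ (outside ∷ p) m = there (image⁺ p m)

image⁻ : ∀ {n} (p : Subset n) {q : Subset ∣ p ∣} {x} → x Subset.∈ image p q →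
         ∃[ i ] i Subset.∈ q × embed p i ≡ x
image⁻ (inside  ∷ p) {s ∷ q} here = zero , here , refl
image⁻ (inside  ∷ p) {s ∷ q} (there m) =
  let i , i∈ , e = image⁻ p m in suc i , there i∈ , cong suc e
image⁻ (outside ∷ p) (there m) =
  let i , i∈ , e = image⁻ p m in i , i∈ , cong suc e

-- Finite graphs on arbitrary types of points

-- With an arbitrary type of points, cones and glued graphs live on `Maybe` and on sums, where old
-- and new points are told apart by their constructor. The list `points` is what inductions over
-- finite subspaces run through.
record Space : Set₁ where
  infix 4 _~_ _~?_ _≟_
  field
    V        : Set
    _~_      : V → V → Set
    _≟_      : ∀ (x y : V) → Dec (x ≡ y)
    _~?_     : ∀ x y → Dec (x ~ y)
    ~-sym    : ∀ {x y} → x ~ y → y ~ x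
    ~-irrefl : ∀ {x} → ¬ x ~ x
    points   : List V
    complete : ∀ x → x ∈ᴸ points

open Space using (V)

⟨_⟩ : Graph → Space
⟨ G ⟩ = record
  { V        = Point G
  ; _~_      = Adjacent G
  ; _≟_      = _≟ᶠ_
  ; _~?_     = λ x y → y ∈? O G x
  ; ~-sym    = O-sym G
  ; ~-irrefl = O-irrefl G
  ; points   = allFin (order G)
  ; complete = ∈-allFin
  }

cone : (X : Space) {C : Pred (V X) 0ℓ} → Decidable C → Space
cone X {C} C? = record
  { V        = Maybe (Space.V X)
  ; _~_      = _~⁺_
  ; _≟_      = ≡-decᴹ _≟_
  ; _~?_     = λ { (just x) (just y) → x ~? y
                 ; (just x) nothing  → C? x
                 ; nothing  (just y) → C? y
                 ; nothing  nothing  → no λ () }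
  ; ~-sym    = λ { {just x} {just y} → ~-sym ; {just x} {nothing} → id ; {nothing} {just y} → id }
  ; ~-irrefl = λ { {just x} → ~-irrefl ; {nothing} () }
  ; points   = nothing ∷ mapᴸ just points
  ; complete = λ { nothing → here refl ; (just x) → there (∈-map⁺ just (complete x)) }
  }
  where
  open Space X
  _~⁺_ : Maybe (Space.V X) → Maybe (Space.V X) → Set
  just x  ~⁺ just y  = x ~ y
  just x  ~⁺ nothing = C x
  nothing ~⁺ just y  = C y
  nothing ~⁺ nothing = ⊥

linkedSpace : (G H : Graph) {R : Point G → Point H → Set} → (∀ x y → Dec (R x y)) → Space
linkedSpace G H {R} R? = record
  { V        = Point G ⊎ Point H
  ; _~_      = Cross G H R
  ; _≟_      = ≡-dec⊎ _≟ᶠ_ _≟ᶠ_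
  ; _~?_     = Cross? G H R?
  ; ~-sym    = λ {a} {b} → Cross-sym G H a b
  ; ~-irrefl = λ {a} → Cross-irrefl G H a
  ; points   = mapᴸ inj₁ (allFin _) ++ mapᴸ inj₂ (allFin _)
  ; complete = λ { (inj₁ x) → ∈-++⁺ˡ (∈-map⁺ inj₁ (∈-allFin x))
                 ; (inj₂ y) → ∈-++⁺ʳ (mapᴸ inj₁ (allFin _)) (∈-map⁺ inj₂ (∈-allFin y)) }
  }

-- An isomorphism of G with the subspace P of X.
record Listing (X : Space) (P : Pred (V X) 0ℓ) (G : Graph) : Set where
  open Space X using (_~_)
  field
    at       : Point G → V X
    at-∈     : ∀ i → P (at i)
    onto     : ∀ {x} → P x → ∃[ i ] at i ≡ x
    at-inj   : ∀ {i j} → at i ≡ at j → i ≡ j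
    adj⁺     : ∀ {i j} → Adjacent G i j → at i ~ at j
    adj⁻     : ∀ {i j} → at i ~ at j → Adjacent G i j

open Listing

module _ {X : Space} where
  open Space X

  listing-resp : ∀ {P Q G} → P ≐ Q → Listing X P G → Listing X Q G
  listing-resp (P⊆Q , Q⊆P) L = record
    { at = at L ; at-∈ = λ i → P⊆Q (at-∈ L i) ; onto = λ q → onto L (Q⊆P q)
    ; at-inj = at-inj L ; adj⁺ = adj⁺ L ; adj⁻ = adj⁻ L }

  listing-∘ : ∀ {P G H} {Q : Pred (Point G) 0ℓ} (L : Listing X P G) → Listing ⟨ G ⟩ Q H →
              Listing X (λ x → ∃[ i ] Q i × at L i ≡ x) H
  listing-∘ L M = record
    { at = at L ∘ at M
    ; at-∈ = λ i → at M i , at-∈ M i , refl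
    ; onto = λ { (i , q , refl) → let j , e = onto M q in j , cong (at L) e }
    ; at-inj = λ e → at-inj M (at-inj L e)
    ; adj⁺ = λ a → adj⁺ L (adj⁺ M a)
    ; adj⁻ = λ a → adj⁻ M (adj⁻ L a) }

  listing-dec : ∀ {P G} → Listing X P G → Decidable P
  listing-dec {P} L x = map′ (λ (i , e) → subst P e (at-∈ L i)) (onto L) (any? λ i → at L i ≟ x)

  module _ {P G H} (L : Listing X P G) (M : Listing X P H) where
    private
      f : Point G → Point H
      f i = proj₁ (onto M (at-∈ L i))
      g : Point H → Point G
      g j = proj₁ (onto L (at-∈ M j))
      f-at : ∀ i → at M (f i) ≡ at L i
      f-at i = proj₂ (onto M (at-∈ L i))
      g-at : ∀ j → at L (g j) ≡ at M j
      g-at j = proj₂ (onto L (at-∈ M j))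

    -- The second component records which points are matched; gluing along the isomorphism in
    -- `sph⇒sphere` depends on it.
    same-listing : ∃[ φ ] (∀ i → at M (_≅_.to {G} {H} φ i) ≡ at L i)
    same-listing = record
      { bijection = mk↔ₛ′ f g (λ j → at-inj M (trans (f-at (g j)) (g-at j)))
                              (λ i → at-inj L (trans (g-at (f i)) (f-at i)))
      ; adjacency = λ i j → mk⇔
          (λ a → adj⁻ M (subst₂ _~_ (sym (f-at i)) (sym (f-at j)) (adj⁺ L a)))
          (λ a → adj⁻ L (subst₂ _~_ (f-at i) (f-at j) (adj⁺ M a))) } , f-at

    listed-≅ : G ≅ H
    listed-≅ = proj₁ same-listing

iso-listing : ∀ {G H} → G ≅ H → Listing ⟨ H ⟩ U G
iso-listing {G} {H} φ = record
  { at = _≅_.to φ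
  ; at-∈ = _
  ; onto = λ {x} _ → from x , strictlyInverseˡ x
  ; at-inj = λ {i} {j} e → trans (sym (strictlyInverseʳ i)) (trans (cong from e) (strictlyInverseʳ j))
  ; adj⁺ = ⇒ (_≅_.adjacency φ _ _)
  ; adj⁻ = ⇐ (_≅_.adjacency φ _ _) }
  where open Inverse (_≅_.bijection φ)

all-listing : ∀ G → Listing ⟨ G ⟩ U G
all-listing G = record
  { at = id ; at-∈ = _ ; onto = λ {x} _ → x , refl ; at-inj = id ; adj⁺ = id ; adj⁻ = id }

induced-listing : ∀ G p → Listing ⟨ G ⟩ (Subset._∈ p) (induced G p)
induced-listing G p = record
  { at = embed p
  ; at-∈ = embed-∈ p
  ; onto = embed-surjective p
  ; at-inj = embed-injective p
  ; adj⁺ = λ {i} {j} → ⇒ (adj i j)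
  ; adj⁻ = λ {i} {j} → ⇐ (adj i j) }
  where
  adj : ∀ i j → Adjacent (induced G p) i j ⇔ Adjacent G (embed p i) (embed p j)
  adj = nbrs-⇔ (λ i j → embed p j ∈? O G (embed p i))

linked-listing : ∀ G H {R : Point G → Point H → Set} (R? : ∀ x y → Dec (R x y)) →
                 Listing (linkedSpace G H R?) U (linked G H R?)
linked-listing G H {R} R? = record
  { at = splitAt (order G)
  ; at-∈ = _
  ; onto = λ {x} _ → join _ _ x , splitAt-join _ _ x
  ; at-inj = λ {i} {j} e → trans (sym (join-splitAt (order G) (order H) i))
                          (trans (cong (join _ _) e) (join-splitAt (order G) (order H) j))
  ; adj⁺ = λ {i} {j} → ⇒ (adj i j)
  ; adj⁻ = λ {i} {j} → ⇐ (adj i j) }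
  where
  adj : ∀ i j → Adjacent (linked G H R?) i j ⇔
                Cross G H R (splitAt (order G) i) (splitAt (order G) j)
  adj = nbrs-⇔ (λ v u → Cross? G H R? (splitAt (order G) v) (splitAt (order G) u))

joinTo-⇔ : ∀ G v p x y → Adjacent (joinTo G v p) x y ⇔
  (Adjacent G x y ⊎ x ≢ y × (x ≡ v × y Subset.∈ p ⊎ y ≡ v × x Subset.∈ p))
joinTo-⇔ G v p = nbrs-⇔ (λ x y → (y ∈? O G x) ⊎-dec
  (¬? (x ≟ᶠ y) ×-dec (((x ≟ᶠ v) ×-dec (y ∈? p)) ⊎-dec ((y ≟ᶠ v) ×-dec (x ∈? p)))))

addPoint-listing : ∀ G p → Listing (cone ⟨ G ⟩ (_∈? p)) U (addPoint G p)
addPoint-listing G p = record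
  { at = at′
  ; at-∈ = _
  ; onto = λ { {nothing} _ → zero , refl ; {just x} _ → suc x , refl }
  ; at-inj = inj
  ; adj⁺ = λ {i} {j} → ⇒ (adj i j) ∘ ⇒ (linked-adj i j)
  ; adj⁻ = λ {i} {j} → ⇐ (linked-adj i j) ∘ ⇐ (adj i j) }
  where
  open Space (cone ⟨ G ⟩ (_∈? p))
  R : Point K₁ → Point G → Set
  R _ x = x Subset.∈ p
  linked-adj : ∀ i j → Adjacent (addPoint G p) i j ⇔ Cross K₁ G R (splitAt 1 i) (splitAt 1 j)
  linked-adj = nbrs-⇔ (λ v u → Cross? K₁ G {R} (λ _ x → x ∈? p) (splitAt 1 v) (splitAt 1 u))
  at′ : Fin (suc (order G)) → Maybe (Point G)
  at′ zero    = nothing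
  at′ (suc x) = just x
  inj : ∀ {i j} → at′ i ≡ at′ j → i ≡ j
  inj {zero}  {zero}  _    = refl
  inj {suc i} {suc j} refl = refl
  adj : ∀ i j → Cross K₁ G R (splitAt 1 i) (splitAt 1 j) ⇔ (at′ i ~ at′ j)
  adj zero    zero    = mk⇔ (O-irrefl K₁ {zero}) (λ ())
  adj zero    (suc j) = mk⇔ id id
  adj (suc i) zero    = mk⇔ id id
  adj (suc i) (suc j) = mk⇔ id id

-- Subspaces of a space: contractibility, spheres, disks, manifolds

module Geometry (X : Space) where
  open Space X hiding (V)

  Subspace : Set₁
  Subspace = Pred (V X) 0ℓ

  infixl 7 _↾_ _∖_

  _↾_ : Subspace → V X → Subspace
  (P ↾ x) y = P y × x ~ y

  _∖_ : Subspace → V X → Subspace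
  (P ∖ x) y = P y × y ≢ x

  Path : Subspace → V X → V X → Set
  Path P = Star (λ x y → P x × P y × x ~ y)

  Conn : Subspace → Set
  Conn P = ∃ P × (∀ {x y} → P x → P y → Path P x y)

  -- Connectedness travels together with contractibility: a rim with both properties lets both pass
  -- through the addition or deletion of a point.
  record Tame (P : Subspace) : Set where
    constructor tame
    field
      conn         : Conn P
      {graph}      : Graph
      contractible : Contractible graph
      listing      : Listing X P graph

  open Tame public

  -- Unlike in the definitions from the paper, the same recursion covers the
  -- dimensions 0 and 1, and the boundary of a rim is prescribed.
  data Sph (P : Subspace) : ℕ → Set where
    sph₀ : ∀ a b → P a → P b → a ≢ b → ¬ a ~ b → P ⊆ ｛ a ｝ ∪ ｛ b ｝ → Sph P 0
    sph₊ : ∀ {n} → Conn P → (∀ {x} → P x → Sph (P ↾ x) n) →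
           (∃[ u ] P u × Tame (P ∖ u)) → Sph P (suc n)

  data Disk (B I : Subspace) : ℕ → Set

  -- The disk B ∪ I with boundary B and interior I.
  record Disk₊ (B I : Subspace) (n : ℕ) : Set where
    inductive
    field
      whole        : Tame (B ∪ I)
      B-nonempty   : ∃ B
      I-nonempty   : ∃ I
      disjoint     : ∀ {x} → B x → ¬ I x
      B-rim        : ∀ {x} → B x → Disk (B ↾ x) (I ↾ x) n
      I-rim        : ∀ {x} → I x → Sph ((B ∪ I) ↾ x) n
      B-sphere     : Sph B n

  data Disk B I where
    disk₀ : ∀ i → (∀ {x} → ¬ B x) → I i → I ⊆ ｛ i ｝ → Disk B I 0
    disk₊ : ∀ {n} → Disk₊ B I n → Disk B I (suc n)

  open Disk₊ public

  -- The index is the dimension of the rims, so that of the manifold is one higher.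
  Man : Subspace → ℕ → Set
  Man P n = Conn P × (∀ {x} → P x → Sph (P ↾ x) n)

  ~⇒≢ : ∀ {x y} → x ~ y → x ≢ y
  ~⇒≢ r refl = ~-irrefl r

  ∪-↾ : ∀ {P Q} x → (P ∪ Q) ↾ x ≐ (P ↾ x) ∪ (Q ↾ x)
  ∪-↾ x = (λ { (inj₁ p , r) → inj₁ (p , r) ; (inj₂ q , r) → inj₂ (q , r) })
        , (λ { (inj₁ (p , r)) → inj₁ p , r ; (inj₂ (q , r)) → inj₂ q , r })

  path-sym : ∀ {P x y} → Path P x y → Path P y x
  path-sym = Star.reverse λ (p , q , r) → q , p , ~-sym r

  path-mono : ∀ {P Q x y} → P ⊆ Q → Path P x y → Path Q x y
  path-mono f = Star.map λ (p , q , r) → f p , f q , r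

  conn-from : ∀ {P c} → P c → (∀ {x} → P x → Path P x c) → Conn P
  conn-from c∈ path = (_ , c∈) , λ x∈ y∈ → path x∈ ◅◅ path-sym (path y∈)

  -- Induction along paths. It serves to show that a part of a sphere or a circle which contains all
  -- neighbours of its points is everything.
  conn-closed : ∀ {P x} {Q : Subspace} → Conn P → P x → Q x →
                (∀ {y z} → Q y → P y → P z → y ~ z → Q z) → P ⊆ Q
  conn-closed {P} {x} {Q} (_ , conn) x∈P x∈Q closed y∈P = go x∈Q (conn x∈P y∈P)
    where
    go : ∀ {a b} → Q a → Path P a b → Q b
    go q ε = q
    go q ((p , p′ , r) ◅ path) = go (closed q p p′ r) path

  tame-dec : ∀ {P} → Tame P → Decidable P
  tame-dec t = listing-dec (listing t)

  sph-nonempty : ∀ {P n} → Sph P n → ∃ P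
  sph-nonempty (sph₀ a _ a∈ _ _ _ _) = a , a∈
  sph-nonempty (sph₊ (ne , _) _ _)   = ne

-- Transport along partial isomorphisms

-- A partial isomorphism between X and Y.
record Correspondence (X Y : Space) : Set₁ where
  private
    module X = Space X
    module Y = Space Y
  field
    R          : V X → V Y → Set
    functional : ∀ {x y y′} → R x y → R x y′ → y ≡ y′
    injective  : ∀ {x x′ y} → R x y → R x′ y → x ≡ x′
    adj        : ∀ {x x′ y y′} → R x y → R x′ y′ → x X.~ x′ → y Y.~ y′
    adj⁻¹      : ∀ {x x′ y y′} → R x y → R x′ y′ → y Y.~ y′ → x X.~ x′

flip : ∀ {X Y} → Correspondence X Y → Correspondence Y X
flip ρ = record { R = λ y x → R x y ; functional = injective ; injective = functional
                ; adj = adj⁻¹ ; adj⁻¹ = adj }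
  where open Correspondence ρ

identity : ∀ X → Correspondence X X
identity X = record { R = _≡_ ; functional = λ { refl e → e } ; injective = λ { refl e → sym e }
                    ; adj = λ { refl refl r → r } ; adj⁻¹ = λ { refl refl r → r } }

listed : ∀ {X P G} → Listing X P G → Correspondence ⟨ G ⟩ X
listed L = record
  { R = λ i x → at L i ≡ x ; functional = λ { refl e → e } ; injective = λ { refl e → at-inj L (sym e) }
  ; adj = λ { refl refl → adj⁺ L } ; adj⁻¹ = λ { refl refl → adj⁻ L } }

to-cone : ∀ X {C : Pred (V X) 0ℓ} (C? : Decidable C) → Correspondence X (cone X C?)
to-cone X C? = record
  { R = λ x y → just x ≡ y ; functional = λ { refl e → e } ; injective = λ { refl refl → refl }
  ; adj = λ { refl refl r → r } ; adj⁻¹ = λ { refl refl r → r } }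

module _ {X Y : Space} where
  private
    module X = Geometry X
    module Y = Geometry Y

  module _ (ρ : Correspondence X Y) where
    open Correspondence ρ

    -- Together with the axioms of a correspondence this makes `R` an isomorphism of `P` with `Q`.
    -- As a relation it may be undefined elsewhere, and it is reversed by `flip` without computing
    -- an inverse.
    Maps : X.Subspace → Y.Subspace → Set
    Maps P Q = (∀ {x} → P x → ∃[ y ] R x y × Q y) × (∀ {y} → Q y → ∃[ x ] R x y × P x)

module _ {X Y : Space} (ρ : Correspondence X Y) where
  open Correspondence ρ
  private
    module X where
      open Space X public
      open Geometry X public
    module Y where
      open Space Y public
      open Geometry Y public

  maps-∪ : ∀ {P Q P′ Q′} → Maps ρ P Q → Maps ρ P′ Q′ → Maps ρ (P ∪ P′) (Q ∪ Q′)
  maps-∪ (f , g) (f′ , g′) =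
      [ (λ p → let y , r , q = f p in y , r , inj₁ q) , (λ p → let y , r , q = f′ p in y , r , inj₂ q) ]′
    , [ (λ p → let y , r , q = g p in y , r , inj₁ q) , (λ p → let y , r , q = g′ p in y , r , inj₂ q) ]′

  mapped : ∀ {P Q x y} → Maps ρ P Q → R x y → P x → Q y
  mapped {Q = Q} (f , _) r p = let _ , r′ , q = f p in subst Q (functional r′ r) q

  mapped⁻¹ : ∀ {P Q x y} → Maps ρ P Q → R x y → Q y → P x
  mapped⁻¹ {P = P} (_ , g) r q = let _ , r′ , p = g q in subst P (injective r′ r) p

  maps-rim : ∀ {P Q x y} → Maps ρ P Q → R x y → Maps ρ (P X.↾ x) (Q Y.↾ y)
  maps-rim (f , g) r =
      (λ (p , a) → let y′ , r′ , q = f p in y′ , r′ , q , adj r r′ a)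
    , (λ (q , a) → let x′ , r′ , p = g q in x′ , r′ , p , adj⁻¹ r r′ a)

  maps-∖ : ∀ {P Q x y} → Maps ρ P Q → R x y → Maps ρ (P X.∖ x) (Q Y.∖ y)
  maps-∖ (f , g) r =
      (λ (p , n) → let y′ , r′ , q = f p in y′ , r′ , q , λ e → n (injective (subst (R _) e r′) r))
    , (λ (q , n) → let x′ , r′ , p = g q in x′ , r′ , p , λ e → n (functional (subst (λ z → R z _) e r′) r))

  private
    path-maps : ∀ {P Q x x′ y} → Maps ρ P Q → X.Path P x x′ → R x y →
                ∃[ y′ ] R x′ y′ × Y.Path Q y y′
    path-maps m ε r = _ , r , ε
    path-maps m ((p , p′ , a) ◅ path) r =
      let y₁ , r₁ , q₁   = proj₁ m p′
          y′ , r′ , path′ = path-maps m path r₁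
      in y′ , r′ , (mapped m r p , q₁ , adj r r₁ a) ◅ path′

  conn-transport : ∀ {P Q} → Maps ρ P Q → X.Conn P → Y.Conn Q
  conn-transport {P} {Q} m ((x , p) , path) = map₂ proj₂ (proj₁ m p) , λ q q′ →
    let x₁ , r₁ , p₁     = proj₂ m q
        x₂ , r₂ , p₂     = proj₂ m q′
        y′ , r′ , path′ = path-maps m (path p₁ p₂) r₁
    in subst (Y.Path Q _) (functional r′ r₂) path′

  listing-transport : ∀ {P Q G} → Maps ρ P Q → Listing X P G → Listing Y Q G
  listing-transport {P} {Q} {G} (f , g) L = record
    { at = h
    ; at-∈ = λ i → proj₂ (proj₂ (f (at-∈ L i)))
    ; onto = λ q → let x , r , p = g q ; i , e = onto L p
                   in i , functional (rel i) (subst (λ z → R z _) (sym e) r)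
    ; at-inj = λ {i} {j} e → at-inj L (injective (rel i) (subst (R _) (sym e) (rel j)))
    ; adj⁺ = λ a → adj (rel _) (rel _) (adj⁺ L a)
    ; adj⁻ = λ a → adj⁻ L (adj⁻¹ (rel _) (rel _) a) }
    where
    h : Point G → V Y
    h i = proj₁ (f (at-∈ L i))
    rel : ∀ i → R (at L i) (h i)
    rel i = proj₁ (proj₂ (f (at-∈ L i)))

  tame-transport : ∀ {P Q} → Maps ρ P Q → X.Tame P → Y.Tame Q
  tame-transport m t =
    Y.tame (conn-transport m (X.conn t)) (X.contractible t) (listing-transport m (X.listing t))

  sph-transport : ∀ {n P Q} → Maps ρ P Q → X.Sph P n → Y.Sph Q n
  sph-transport (f , g) (X.sph₀ a b a∈ b∈ a≢b a≁b all) =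
    let a′ , ra , qa = f a∈
        b′ , rb , qb = f b∈
    in Y.sph₀ a′ b′ qa qb (λ e → a≢b (injective ra (subst (R b) (sym e) rb))) (λ s → a≁b (adj⁻¹ ra rb s))
         (λ q → let x , r , p = g q in
           map⊎ (λ e → functional ra (subst (λ z → R z _) (sym e) r))
                (λ e → functional rb (subst (λ z → R z _) (sym e) r)) (all p))
  sph-transport m@(f , g) (X.sph₊ conn rims (u , u∈ , t)) =
    let u′ , r , q = f u∈
    in Y.sph₊ (conn-transport m conn)
         (λ q → let x , r , p = g q in sph-transport (maps-rim m r) (rims p))
         (u′ , q , tame-transport (maps-∖ m r) t)

  man-transport : ∀ {n P Q} → Maps ρ P Q → X.Man P n → Y.Man Q n
  man-transport m (conn , rims) = conn-transport m conn ,
    λ q → let x , r , p = proj₂ m q in sph-transport (maps-rim m r) (rims p)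

  disk-transport : ∀ {n B I B′ I′} → Maps ρ B B′ → Maps ρ I I′ → X.Disk B I n → Y.Disk B′ I′ n
  disk-transport (_ , g) (f , g′) (X.disk₀ i none i∈ all) =
    let i′ , r , q = f i∈ in
    Y.disk₀ i′ (λ q → none (proj₂ (proj₂ (g q)))) q
      λ q → let x , r′ , p = g′ q in functional r (subst (λ z → R z _) (sym (all p)) r′)
  disk-transport b i (X.disk₊ d) = Y.disk₊ record
    { whole = tame-transport (maps-∪ b i) (X.whole d)
    ; B-nonempty = map₂ proj₂ (proj₁ b (proj₂ (X.B-nonempty d)))
    ; I-nonempty = map₂ proj₂ (proj₁ i (proj₂ (X.I-nonempty d)))
    ; disjoint = λ q q′ → let x , r , p = proj₂ b q in X.disjoint d p (mapped⁻¹ i r q′)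
    ; B-rim = λ q → let x , r , p = proj₂ b q in
        disk-transport (maps-rim b r) (maps-rim i r) (X.B-rim d p)
    ; I-rim = λ q → let x , r , p = proj₂ i q in
        sph-transport (maps-rim (maps-∪ b i) r) (X.I-rim d p)
    ; B-sphere = sph-transport b (X.B-sphere d) }

maps-flip : ∀ {X Y} {ρ : Correspondence X Y} {P Q} → Maps ρ P Q → Maps (flip ρ) Q P
maps-flip (f , g) = g , f

module Respect (X : Space) where
  open Geometry X

  maps-≐ : ∀ {P Q} → P ≐ Q → Maps (identity X) P Q
  maps-≐ (f , g) = (λ p → _ , refl , f p) , (λ q → _ , refl , g q)

  tame-resp : ∀ {P Q} → P ≐ Q → Tame P → Tame Q
  tame-resp e = tame-transport (identity X) (maps-≐ e)

  sph-resp : ∀ {n P Q} → P ≐ Q → Sph P n → Sph Q n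
  sph-resp e = sph-transport (identity X) (maps-≐ e)

  disk-resp : ∀ {n B I B′ I′} → B ≐ B′ → I ≐ I′ → Disk B I n → Disk B′ I′ n
  disk-resp e e′ = disk-transport (identity X) (maps-≐ e) (maps-≐ e′)

-- Contractible transformations inside a space

module Tameness (X : Space) where
  open Space X hiding (V)
  open Geometry X
  open Respect X

  conn-add : ∀ {P x} → ∃ (P ↾ x) → Conn P → Conn (P ∪ ｛ x ｝)
  conn-add {P} {x} (y , y∈P , x~y) (_ , path) = conn-from (inj₁ y∈P) λ
    { (inj₁ p)    → path-mono inj₁ (path p y∈P)
    ; (inj₂ refl) → (inj₂ refl , inj₁ y∈P , x~y) ◅ ε }

  -- Whenever a path passes through `x`, it enters and leaves by neighbours of `x`, and these are
  -- joined by a detour inside the connected rim.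
  conn-delete : ∀ {P x} → Conn (P ↾ x) → Conn P → Conn (P ∖ x)
  conn-delete {P} {x} ((y , y∈ , x~y) , rim-path) (_ , path) =
      (y , y∈ , ≢-sym (~⇒≢ x~y)) , λ { (a∈ , a≢) (b∈ , b≢) → outside-x b≢ a≢ (path a∈ b∈) }
    where
    outside-x : ∀ {a b} → b ≢ x → a ≢ x → Path P a b → Path (P ∖ x) a b
    at-x : ∀ {a b} → b ≢ x → (P ↾ x) a → Path P x b → Path (P ∖ x) a b
    outside-x b≢ a≢ ε = ε
    outside-x b≢ a≢ (_◅_ {j = c} (a∈ , c∈ , r) path) with c ≟ x
    ... | yes refl = at-x b≢ (a∈ , ~-sym r) path
    ... | no c≢    = ((a∈ , a≢) , (c∈ , c≢) , r) ◅ outside-x b≢ c≢ path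
    at-x b≢ a∈ ε = ⊥-elim (b≢ refl)
    at-x b≢ a∈ ((_ , c∈ , r) ◅ path) =
      path-mono (λ (p , r) → p , ≢-sym (~⇒≢ r)) (rim-path a∈ (c∈ , r))
        ◅◅ outside-x b≢ (≢-sym (~⇒≢ r)) path

  tame-singleton : ∀ x → Tame ｛ x ｝
  tame-singleton x = tame ((x , refl) , λ { refl refl → ε }) single record
    { at = λ _ → x
    ; at-∈ = λ _ → refl
    ; onto = λ { refl → zero , refl }
    ; at-inj = λ { {zero} {zero} _ → refl }
    ; adj⁺ = λ { {zero} {zero} a → ⊥-elim (O-irrefl K₁ {zero} a) }
    ; adj⁻ = ⊥-elim ∘ ~-irrefl }

  tame-add : ∀ {P x} → ¬ P x → Tame (P ↾ x) → Tame P → Tame (P ∪ ｛ x ｝)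
  tame-add {P} {x} x∉P r t = tame (conn-add (proj₁ (conn r)) (conn t))
      (pointAdd p (relabel (listed-≅ (listing r) rim-listing) (contractible r)) (contractible t))
      (listing-transport ρ maps (addPoint-listing G p))
    where
    G = graph t
    L = listing t
    near? : Decidable (λ i → x ~ at L i)
    near? i = x ~? at L i
    p : Subset (order G)
    p = select near?
    rim-listing : Listing X (P ↾ x) (induced G p)
    rim-listing = listing-resp
      ( (λ { (i , i∈ , refl) → at-∈ L i , select⁻ near? i∈ })
      , (λ { (y∈ , r) → let i , e = onto L y∈ in
             i , select⁺ near? (subst (x ~_) (sym e) r) , e }))
      (listing-∘ L (induced-listing G p))
    R : Maybe (Point G) → V X → Set
    R nothing  y = x ≡ y
    R (just i) y = at L i ≡ y
    ρ : Correspondence (cone ⟨ G ⟩ (_∈? p)) X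
    ρ = record
      { R = R
      ; functional = λ { {nothing} refl refl → refl ; {just i} refl refl → refl }
      ; injective  = λ { {nothing} {nothing} refl e → refl
                       ; {nothing} {just j} refl e → ⊥-elim (x∉P (subst P e (at-∈ L j)))
                       ; {just i} {nothing} e refl → ⊥-elim (x∉P (subst P e (at-∈ L i)))
                       ; {just i} {just j} refl e → cong just (at-inj L (sym e)) }
      ; adj   = λ { {nothing} {just j} refl refl a → select⁻ near? a
                  ; {just i} {nothing} refl refl a → ~-sym (select⁻ near? a)
                  ; {just i} {just j} refl refl a → adj⁺ L a }
      ; adj⁻¹ = λ { {nothing} {nothing} refl refl a → ⊥-elim (~-irrefl a)
                  ; {nothing} {just j} refl refl a → select⁺ near? a
                  ; {just i} {nothing} refl refl a → select⁺ near? (~-sym a)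
                  ; {just i} {just j} refl refl a → adj⁻ L a } }
    maps : Maps ρ U (P ∪ ｛ x ｝)
    maps = (λ { {nothing} _ → x , refl , inj₂ refl ; {just i} _ → at L i , refl , inj₁ (at-∈ L i) })
         , (λ { (inj₁ y∈) → let i , e = onto L y∈ in just i , e , tt
              ; (inj₂ refl) → nothing , refl , tt })

  tame-delete : ∀ {P x} → P x → Tame (P ↾ x) → Tame P → Tame (P ∖ x)
  tame-delete {P} {x} x∈P r t with onto (listing t) x∈P
  ... | i , refl = tame (conn-delete (conn r) (conn t))
      (pointDelete i (relabel (listed-≅ (listing r) rim-listing) (contractible r)) (contractible t))
      (listing-resp
        ( (λ { (j , j∈ , refl) → at-∈ L j , λ e → x∈∁p⇒x∉p j∈ (subst (Subset._∈ ⁅ i ⁆) (at-inj L (sym e)) (x∈⁅x⁆ i)) })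
        , (λ { (y∈ , y≢) → let j , e = onto L y∈ in
             j , x∉p⇒x∈∁p (λ j∈ → y≢ (trans (sym e) (cong (at L) (x∈⁅y⁆⇒x≡y i j∈)))) , e }))
        (listing-∘ L (induced-listing (graph t) (∁ ⁅ i ⁆))))
    where
    L = listing t
    rim-listing : Listing X (P ↾ at L i) (rim (graph t) i)
    rim-listing = listing-resp
      ( (λ { (j , j∈ , refl) → at-∈ L j , adj⁺ L j∈ })
      , (λ { (y∈ , r) → let j , e = onto L y∈ in j , adj⁻ L (subst (at L i ~_) (sym e) r) , e }))
      (listing-∘ L (induced-listing (graph t) (O (graph t) i)))

  -- Cutting `Q` down to a list lets it be built point by point by recursion on the list; entries
  -- that are repeated or lie outside `Q` change nothing.
  _∩ᴸ_ : Subspace → List (V X) → Subspace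
  (Q ∩ᴸ xs) y = Q y × y ∈ᴸ xs

  ∩ᴸ-drop : ∀ {Q x xs} → (Q x → x ∈ᴸ xs) → Q ∩ᴸ (x ∷ xs) ≐ Q ∩ᴸ xs
  ∩ᴸ-drop f = (λ { (q , here refl) → q , f q ; (q , there m) → q , m }) , (λ (q , m) → q , there m)

  ∩ᴸ-take : ∀ {P Q : Subspace} {x xs} → Q x → (P ∪ (Q ∩ᴸ xs)) ∪ ｛ x ｝ ≐ P ∪ (Q ∩ᴸ (x ∷ xs))
  ∩ᴸ-take q =
      (λ { (inj₁ (inj₁ p)) → inj₁ p ; (inj₁ (inj₂ (q , m))) → inj₂ (q , there m)
         ; (inj₂ refl) → inj₂ (q , here refl) })
    , (λ { (inj₁ p) → inj₁ (inj₁ p) ; (inj₂ (q , here refl)) → inj₂ refl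
         ; (inj₂ (q , there m)) → inj₁ (inj₂ (q , m)) })

  ∪-congʳ : ∀ {P Q R : Subspace} → Q ≐ R → P ∪ Q ≐ P ∪ R
  ∪-congʳ (f , g) = map⊎ id f , map⊎ id g

  ∪-all : ∀ {P Q : Subspace} → P ∪ (Q ∩ᴸ points) ≐ P ∪ Q
  ∪-all = map⊎ id proj₁ , map⊎ id (λ q → q , complete _)

  private
    -- The points of `Q` are attached to `w` one at a time. The rim of a new point `x` is again a
    -- star with centre `w`, over those earlier points that are adjacent to `x`; this is why `Q`
    -- varies in the recursion.
    star : ∀ {Q w} xs → Decidable Q → (∀ {y} → Q y → w ~ y) → Tame (｛ w ｝ ∪ (Q ∩ᴸ xs))
    star {Q} {w} [] _ _ = tame-resp (inj₁ , λ { (inj₁ e) → e ; (inj₂ (_ , ())) }) (tame-singleton w)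
    star {Q} {w} (x ∷ xs) Q? r with Q? x | Any.any? (x ≟_) xs
    ... | no ¬q | _     = tame-resp (∪-congʳ (swap (∩ᴸ-drop (⊥-elim ∘ ¬q)))) (star xs Q? r)
    ... | yes q | yes m = tame-resp (∪-congʳ (swap (∩ᴸ-drop (λ _ → m)))) (star xs Q? r)
    ... | yes q | no ¬m = tame-resp (∩ᴸ-take q)
      (tame-add (λ { (inj₁ refl) → ~-irrefl (r q) ; (inj₂ (_ , m)) → ¬m m })
        (tame-resp ( (λ { (inj₁ refl) → inj₁ refl , ~-sym (r q)
                        ; (inj₂ ((q , a) , m)) → inj₂ (q , m) , a })
                   , (λ { (inj₁ e , _) → inj₁ e ; (inj₂ (q , m) , a) → inj₂ ((q , a) , m) }))
          (star xs (λ y → Q? y ×-dec (x ~? y)) (r ∘ proj₁)))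
        (star xs Q? r))

  tame-cone : ∀ {Q w} → Decidable Q → Q w → (∀ {y} → Q y → y ≡ w ⊎ w ~ y) → Tame Q
  tame-cone {Q} {w} Q? w∈Q r = tame-resp
    ( (λ { (inj₁ refl) → w∈Q ; (inj₂ ((q , _) , _)) → q })
    , (λ {y} q → [ (λ e → inj₁ (sym e)) , (λ a → inj₂ ((q , a) , complete y)) ]′ (r q)))
    (star points (λ y → Q? y ×-dec (w ~? y)) proj₂)

  -- The rims of the points of Q are cones with apex w.
  tame-absorb : ∀ {P Q w} → Decidable P → Decidable Q → P w → (∀ {x} → P x → ¬ Q x) →
                (∀ {x} → Q x → w ~ x) →
                (∀ {x y} → Q x → (P ∪ Q) y → x ~ y → y ≡ w ⊎ w ~ y) →
                Tame P ⇔ Tame (P ∪ Q)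
  tame-absorb {P} {Q} {w} P? Q? w∈P P∩Q w~ near = mk⇔
      (tame-resp ∪-all ∘ ⇒ (go points)) (⇐ (go points) ∘ tame-resp (swap ∪-all))
    where
    go : ∀ xs → Tame P ⇔ Tame (P ∪ (Q ∩ᴸ xs))
    go [] = mk⇔ (tame-resp (inj₁ , λ { (inj₁ p) → p ; (inj₂ (_ , ())) })) (tame-resp ((λ { (inj₁ p) → p ; (inj₂ (_ , ())) }) , inj₁))
    go (x ∷ xs) with Q? x | Any.any? (x ≟_) xs
    ... | no ¬q | _ =
      let e = ∪-congʳ {P} (∩ᴸ-drop {Q} {x} {xs} (⊥-elim ∘ ¬q))
      in mk⇔ (tame-resp (swap e) ∘ ⇒ (go xs)) (⇐ (go xs) ∘ tame-resp e)
    ... | yes q | yes m =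
      let e = ∪-congʳ {P} (∩ᴸ-drop {Q} {x} {xs} (λ _ → m))
      in mk⇔ (tame-resp (swap e) ∘ ⇒ (go xs)) (⇐ (go xs) ∘ tame-resp e)
    ... | yes q | no ¬m = mk⇔
        (λ t → tame-resp (∩ᴸ-take q) (tame-add x∉ tame-rim (⇒ (go xs) t)))
        (λ t → ⇐ (go xs) (tame-resp
          ((λ { (inj₁ p , _) → p ; (inj₂ refl , n) → ⊥-elim (n refl) }) ,
           (λ p → inj₁ p , λ { refl → x∉ p }))
          (tame-delete (inj₂ refl) (tame-resp
            ((λ (p , a) → inj₁ p , a) , λ { (inj₁ p , a) → p , a ; (inj₂ refl , a) → ⊥-elim (~-irrefl a) })
            tame-rim) (tame-resp (swap (∩ᴸ-take q)) t))))
      where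
      P′ = P ∪ (Q ∩ᴸ xs)
      x∉ : ¬ P′ x
      x∉ (inj₁ p)       = P∩Q p q
      x∉ (inj₂ (_ , m)) = ¬m m
      tame-rim : Tame (P′ ↾ x)
      tame-rim = tame-cone
        (λ y → (P? y ⊎-dec (Q? y ×-dec Any.any? (y ≟_) xs)) ×-dec (x ~? y))
        (inj₁ w∈P , ~-sym (w~ q))
        (λ (p , a) → near q (map⊎ id proj₁ p) a)

-- Structure of spheres and disks

module Spheres (X : Space) where
  open Space X hiding (V)
  open Geometry X
  open Respect X
  open Tameness X

  Disjoint Apart : Subspace → Subspace → Set
  Disjoint P Q = ∀ {x} → P x → ¬ Q x
  Apart    P Q = ∀ {x y} → P x → Q y → ¬ x ~ y

  sph₀-edgeless : ∀ {P x y} → Sph P 0 → P x → P y → ¬ x ~ y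
  sph₀-edgeless (sph₀ a b _ _ _ a≁b all) x∈ y∈ r with all x∈ | all y∈
  ... | inj₁ refl | inj₁ refl = ~-irrefl r
  ... | inj₁ refl | inj₂ refl = a≁b r
  ... | inj₂ refl | inj₁ refl = a≁b (~-sym r)
  ... | inj₂ refl | inj₂ refl = ~-irrefl r

  sph₀-other : ∀ {P x} → Sph P 0 → P x → ∃[ y ] P y × y ≢ x × P ⊆ ｛ x ｝ ∪ ｛ y ｝
  sph₀-other (sph₀ a b a∈ b∈ a≢b _ all) x∈ with all x∈
  ... | inj₁ refl = b , b∈ , ≢-sym a≢b , all
  ... | inj₂ refl = a , a∈ , a≢b , λ p → [ inj₂ , inj₁ ]′ (all p)

  -- The listing stored in `Tame (P ∖ u)` decides membership away from `u`. The case distinctions on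
  -- boundary and interior points of disks rest on this.
  sph-dec : ∀ {P n} → Sph P n → Decidable P
  sph-dec (sph₀ a b a∈ b∈ _ _ all) x =
    map′ [ (λ { refl → a∈ }) , (λ { refl → b∈ }) ]′ all ((a ≟ x) ⊎-dec (b ≟ x))
  sph-dec (sph₊ _ _ (u , u∈ , t)) x with x ≟ u
  ... | yes refl = yes u∈
  ... | no x≢u   = map′ proj₁ (_, x≢u) (tame-dec t x)

  disk-disjoint : ∀ {B I n} → Disk B I n → Disjoint B I
  disk-disjoint (disk₀ _ none _ _) b = ⊥-elim (none b)
  disk-disjoint (disk₊ d) = disjoint d

  disk-decB : ∀ {B I n} → Disk B I n → Decidable B
  disk-decB (disk₀ _ none _ _) x = no none
  disk-decB (disk₊ d) = sph-dec (B-sphere d)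

  disk-decI : ∀ {B I n} → Disk B I n → Decidable I
  disk-decI (disk₀ i _ i∈ all) x = map′ (λ { refl → i∈ }) all (i ≟ x)
  disk-decI (disk₊ d) x with tame-dec (whole d) x | sph-dec (B-sphere d) x
  ... | no ¬p         | _      = no (¬p ∘ inj₂)
  ... | yes _         | yes b  = no (disjoint d b)
  ... | yes (inj₁ b)  | no ¬b  = ⊥-elim (¬b b)
  ... | yes (inj₂ i)  | no _   = yes i

  disk-tame : ∀ {B I n} → Disk B I n → Tame (B ∪ I)
  disk-tame (disk₀ i none i∈ all) =
    tame-resp ((λ { refl → inj₂ i∈ }) , [ ⊥-elim ∘ none , all ]′) (tame-singleton i)
  disk-tame (disk₊ d) = whole d

  -- By induction on the dimension, a point of `P` has the same rim in `P` as in `Q`. So `P` is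
  -- closed under adjacency in `Q`, and `Q` is connected.
  sub-sphere : ∀ {P Q n} → Sph P n → Sph Q n → P ⊆ Q → Q ⊆ P
  sub-sphere {P} {Q} (sph₀ a b a∈ b∈ a≢b _ _) Q-sphere P⊆Q x∈ with sph₀-other Q-sphere (P⊆Q a∈)
  ... | c , _ , _ , all with all (P⊆Q b∈)
  ... | inj₁ a≡b  = ⊥-elim (a≢b a≡b)
  ... | inj₂ refl = [ (λ { refl → a∈ }) , (λ { refl → b∈ }) ]′ (all x∈)
  sub-sphere {P} {Q} s@(sph₊ ((p , p∈) , _) rims _) (sph₊ conn rims′ _) P⊆Q =
    conn-closed conn (P⊆Q p∈) p∈ λ y∈P y∈Q z∈Q y~z →
      proj₁ (sub-sphere (rims y∈P) (rims′ y∈Q) (λ (p , r) → P⊆Q p , r) (z∈Q , y~z))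

  -- The search descends into the rim of a neighbour `x` of `v`, a sphere of lower dimension that
  -- contains `v`; in dimension 0 the other point is the answer. Such a point makes the interior of
  -- a punctured sphere nonempty.
  non-neighbour : ∀ {P v n} → Sph P n → P v → ∃[ u ] P u × u ≢ v × ¬ v ~ u
  non-neighbour s@(sph₀ _ _ _ _ _ _ _) v∈ =
    let u , u∈ , u≢v , _ = sph₀-other s v∈ in u , u∈ , u≢v , sph₀-edgeless s v∈ u∈
  non-neighbour (sph₊ _ rims _) v∈ =
    let x , x∈ , v~x = sph-nonempty (rims v∈)
        u , (u∈ , _) , u≢v , v≁u = non-neighbour (rims x∈) (v∈ , ~-sym v~x)
    in u , u∈ , u≢v , v≁u

  -- A boundary point of a disk has a rim of the same kind one dimension lower.
  sphere-not-disk : ∀ {B I n} → Disk B I n → ¬ Sph (B ∪ I) n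
  sphere-not-disk {B} {I} (disk₀ i none i∈ all) (sph₀ a b a∈ b∈ a≢b _ _) = a≢b (trans (sym (eq a∈)) (eq b∈))
    where
    eq : B ∪ I ⊆ ｛ i ｝
    eq = [ ⊥-elim ∘ none , all ]′
  sphere-not-disk (disk₊ d) (sph₊ _ rims _) =
    let x , x∈ = B-nonempty d
    in sphere-not-disk (B-rim d x∈) (sph-resp (∪-↾ x) (rims (inj₁ x∈)))

  -- Deleting x and y from P in either order shows that P ∖ x and P ∖ y are
  -- contractible together, as the rims of x and y with a point deleted are.
  punctured-tame : ∀ {P v n} → Sph P n → P v → Tame (P ∖ v)
  punctured-tame {P} {v} s@(sph₀ _ _ _ _ _ _ _) v∈ =
    let u , u∈ , u≢v , all = sph₀-other s v∈ in
    tame-resp ((λ { refl → u∈ , u≢v })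
              , (λ (p , n) → [ (λ e → ⊥-elim (n (sym e))) , id ]′ (all p))) (tame-singleton u)
  punctured-tame {P} {v} (sph₊ (_ , path) rims (u , u∈ , t)) v∈ = along (path u∈ v∈) t
    where
    along : ∀ {x y} → Path P x y → Tame (P ∖ x) → Tame (P ∖ y)
    along ε t = t
    along {x} (_◅_ {j = y} (x∈ , y∈ , x~y) path) t = along path (tame-resp
      ( (λ { (inj₁ ((p , _) , n)) → p , n ; (inj₂ refl) → x∈ , ~⇒≢ x~y })
      , (λ {z} (p , n) → case z p n))
      (tame-add (λ { ((_ , n) , _) → n refl })
        (tame-resp ( (λ { ((p , a) , n) → ((p , ≢-sym (~⇒≢ a)) , n) , a })
                   , (λ { (((p , _) , n) , a) → (p , a) , n }))
          (punctured-tame (rims x∈) (y∈ , x~y)))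
        (tame-delete (y∈ , ≢-sym (~⇒≢ x~y))
          (tame-resp ( (λ { ((p , a) , n) → (p , n) , a }) , (λ { ((p , n) , a) → (p , a) , n }))
            (punctured-tame (rims y∈) (x∈ , ~-sym x~y)))
          t)))
      where
      case : ∀ z → P z → z ≢ y → ((P ∖ x) ∖ y ∪ ｛ x ｝) z
      case z p n with z ≟ x
      ... | yes refl = inj₂ refl
      ... | no z≢x   = inj₁ ((p , z≢x) , n)

  -- Deleting `v` does not affect the rims of its non-neighbours. The rim of a neighbour `x` loses
  -- the point `v`, so it is a punctured sphere of lower dimension, and induction applies.
  punctured-disk : ∀ {P v n} → Sph P n → P v → Disk (P ↾ v) (λ y → P y × y ≢ v × ¬ v ~ y) n
  punctured-disk s@(sph₀ _ _ _ _ _ _ _) v∈ =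
    let u , u∈ , u≢v , all = sph₀-other s v∈ in
    disk₀ u (λ (p , r) → sph₀-edgeless s v∈ p r) (u∈ , u≢v , sph₀-edgeless s v∈ u∈)
      λ (p , n , _) → [ (λ e → ⊥-elim (n (sym e))) , id ]′ (all p)
  punctured-disk {P} {v} s@(sph₊ _ rims _) v∈ = disk₊ record
    { whole = tame-resp
        ((λ {y} (p , n) → case y p n)
        , [ (λ (p , r) → p , ≢-sym (~⇒≢ r)) , (λ (p , n , _) → p , n) ]′)
        (punctured-tame s v∈)
    ; B-nonempty = sph-nonempty (rims v∈)
    ; I-nonempty = non-neighbour s v∈
    ; disjoint = λ (_ , r) (_ , _ , n) → n r
    ; B-rim = λ (x∈ , v~x) → disk-resp
        ((λ ((p , a) , r) → (p , r) , a) , (λ ((p , r) , a) → (p , a) , r))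
        ((λ ((p , a) , n) → (p , n) , a) , (λ ((p , n) , a) → (p , a) , n))
        (punctured-disk (rims x∈) (v∈ , ~-sym v~x))
    ; I-rim = λ (x∈ , x≢v , v≁x) → sph-resp
        ( (λ {y} (p , a) → case y p (λ { refl → v≁x (~-sym a) }) , a)
        , (λ (q , a) → [ proj₁ , proj₁ ]′ q , a))
        (rims x∈)
    ; B-sphere = rims v∈ }
    where
    case : ∀ y → P y → y ≢ v → ((P ↾ v) ∪ (λ y → P y × y ≢ v × ¬ v ~ y)) y
    case y p n with v ~? y
    ... | yes r = inj₁ (p , r)
    ... | no ¬r = inj₂ (p , n , ¬r)

  -- The rim of a boundary point is the cone with the same apex over its rim in `P`; over a 0-sphere
  -- this is the apex alone, a 0-disk.
  cone-disk : ∀ {P w n} → Sph P n → ¬ P w → (∀ {x} → P x → w ~ x) → Disk P ｛ w ｝ (suc n)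
  cone-disk {P} {w} {n} s w∉ w~ = disk₊ record
    { whole = tame-cone (λ x → sph-dec s x ⊎-dec (w ≟ x)) (inj₂ refl)
        [ (λ p → inj₂ (w~ p)) , (λ e → inj₁ (sym e)) ]′
    ; B-nonempty = sph-nonempty s
    ; I-nonempty = w , refl
    ; disjoint = λ { p refl → w∉ p }
    ; B-rim = rims s w∉ w~
    ; I-rim = λ { refl → sph-resp
        ((λ p → inj₁ p , w~ p) , λ { (inj₁ p , _) → p ; (inj₂ refl , a) → ⊥-elim (~-irrefl a) }) s }
    ; B-sphere = s }
    where
    rims : ∀ {P n x} → Sph P n → ¬ P w → (∀ {x} → P x → w ~ x) → P x →
           Disk (P ↾ x) (｛ w ｝ ↾ x) n
    rims s@(sph₀ _ _ _ _ _ _ _) w∉ w~ x∈ =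
      disk₀ w (λ (p , r) → sph₀-edgeless s x∈ p r) (refl , ~-sym (w~ x∈)) proj₁
    rims (sph₊ _ rims′ _) w∉ w~ x∈ = disk-resp
      (id , id) ((λ { refl → refl , ~-sym (w~ x∈) }) , proj₁)
      (cone-disk (rims′ x∈) (w∉ ∘ proj₁) (w~ ∘ proj₁))

  -- The disk itself is the contractible complement of `w` that a sphere requires. At a point of `B`
  -- the rim is a disk of lower dimension capped by the same `w`.
  capped-disk : ∀ {B I w n} → Disk B I n → ¬ (B ∪ I) w → (∀ {x} → B x → w ~ x) →
                (∀ {x} → I x → ¬ w ~ x) → Sph ((B ∪ I) ∪ ｛ w ｝) n
  capped-disk {B} {I} {w} (disk₀ i none i∈ all) w∉ _ w≁ =
    sph₀ i w (inj₁ (inj₂ i∈)) (inj₂ refl) (λ { refl → w∉ (inj₂ i∈) }) (w≁ i∈ ∘ ~-sym)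
      λ { (inj₁ (inj₁ b)) → ⊥-elim (none b) ; (inj₁ (inj₂ i)) → inj₁ (all i) ; (inj₂ e) → inj₂ e }
  capped-disk {B} {I} {w} (disk₊ d) w∉ w~ w≁ = sph₊
    (conn-add (let b , b∈ = B-nonempty d in b , inj₁ b∈ , w~ b∈) (conn (whole d)))
    (λ { {x} (inj₁ (inj₁ b)) → sph-resp
           ( (λ { (inj₁ (inj₁ (b , a))) → inj₁ (inj₁ b) , a ; (inj₁ (inj₂ (i , a))) → inj₁ (inj₂ i) , a
                ; (inj₂ refl) → inj₂ refl , ~-sym (w~ b) })
           , (λ { (inj₁ (inj₁ b) , a) → inj₁ (inj₁ (b , a)) ; (inj₁ (inj₂ i) , a) → inj₁ (inj₂ (i , a))
                ; (inj₂ refl , _) → inj₂ refl }))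
           (capped-disk (B-rim d b) [ w∉ ∘ inj₁ ∘ proj₁ , w∉ ∘ inj₂ ∘ proj₁ ]′ (w~ ∘ proj₁) (w≁ ∘ proj₁))
       ; {x} (inj₁ (inj₂ i)) → sph-resp
           ( (λ (p , a) → inj₁ p , a)
           , (λ { (inj₁ p , a) → p , a ; (inj₂ refl , a) → ⊥-elim (w≁ i (~-sym a)) }))
           (I-rim d i)
       ; (inj₂ refl) → sph-resp
           ( (λ b → inj₁ (inj₁ b) , w~ b)
           , (λ { (inj₁ (inj₁ b) , _) → b ; (inj₁ (inj₂ i) , a) → ⊥-elim (w≁ i a)
                ; (inj₂ refl , a) → ⊥-elim (~-irrefl a) }))
           (B-sphere d) })
    (w , inj₂ refl , tame-resp
      ( (λ p → inj₁ p , λ { refl → w∉ p })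
      , (λ { (inj₁ p , _) → p ; (inj₂ refl , n) → ⊥-elim (n refl) }))
      (whole d))

  -- If y ∈ B′ were interior, then the rim of x in the sphere (B ∪ I) ↾ y and
  -- the rim of y in the disk B′ ∪ I′ would coincide. So B′ is a subsphere of B ↾ x.
  rim-disk : ∀ {B I B′ I′ x n} → Sph B (suc n) → (∀ {y} → I y → Sph ((B ∪ I) ↾ y) (suc n)) →
             Disjoint B I → B x → Disk B′ I′ (suc n) → B′ ∪ I′ ≐ (B ∪ I) ↾ x →
             Disk (B ↾ x) (I ↾ x) (suc n)
  rim-disk {B} {I} {B′} {I′} {x} {n} (sph₊ _ B-rims _) I-rims B∩I x∈ d@(disk₊ d₊) (to , from) =
    disk-resp (B′⊆B , B⊆B′) (I′⊆I , I⊆I′) d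
    where
    not-interior : ∀ {y} → B′ y → ¬ I y
    not-interior {y} b i with I-rims i
    ... | sph₊ _ rims _ = sphere-not-disk (B-rim d₊ b) (sph-resp
      ( (λ ((p , y~z) , x~z) → [ (λ b → inj₁ (b , y~z)) , (λ i → inj₂ (i , y~z)) ]′ (from (p , x~z)))
      , (λ { (inj₁ (b , y~z)) → let p , x~z = to (inj₁ b) in (p , y~z) , x~z
           ; (inj₂ (i , y~z)) → let p , x~z = to (inj₂ i) in (p , y~z) , x~z }))
      (rims (inj₁ x∈ , ~-sym (proj₂ (to (inj₁ b))))))
    B′⊆B : B′ ⊆ B ↾ x
    B′⊆B b with to (inj₁ b)
    ... | inj₁ b′ , a = b′ , a
    ... | inj₂ i  , a = ⊥-elim (not-interior b i)
    B⊆B′ : B ↾ x ⊆ B′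
    B⊆B′ = sub-sphere (B-sphere d₊) (B-rims x∈) B′⊆B
    I′⊆I : I′ ⊆ I ↾ x
    I′⊆I i with to (inj₂ i)
    ... | inj₁ b  , a = ⊥-elim (disjoint d₊ (B⊆B′ (b , a)) i)
    ... | inj₂ i′ , a = i′ , a
    I⊆I′ : I ↾ x ⊆ I′
    I⊆I′ (i , a) with from (inj₂ i , a)
    ... | inj₁ b  = ⊥-elim (B∩I (proj₁ (B′⊆B b)) i)
    ... | inj₂ i′ = i′

  -- Suspension by two poles

  module _ {a b : V X} (a≢b : a ≢ b) (a≁b : ¬ a ~ b) where

    private
      Poles : Subspace
      Poles = ｛ a ｝ ∪ ｛ b ｝

    Suspends : Subspace → Set
    Suspends P = ∀ {x} → P x → (x ≢ a × x ≢ b) × (a ~ x × b ~ x)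

    -- A suspension is the cone with apex `a`, a disk with boundary `P`, capped by `b`.
    suspended-sphere : ∀ {P n} → Suspends P → Sph P n → Sph (P ∪ Poles) (suc n)
    suspended-sphere σ s = sph-resp
      ( (λ { (inj₁ (inj₁ p)) → inj₁ p ; (inj₁ (inj₂ e)) → inj₂ (inj₁ e) ; (inj₂ e) → inj₂ (inj₂ e) })
      , (λ { (inj₁ p) → inj₁ (inj₁ p) ; (inj₂ (inj₁ e)) → inj₁ (inj₂ e) ; (inj₂ (inj₂ e)) → inj₂ e }))
      (capped-disk (cone-disk s (λ p → proj₁ (proj₁ (σ p)) refl) (proj₁ ∘ proj₂ ∘ σ))
        [ (λ p → proj₂ (proj₁ (σ p)) refl) , a≢b ]′
        (proj₂ ∘ proj₂ ∘ σ) (λ { refl → a≁b ∘ ~-sym }))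

    poles-sphere : ∀ {P} → P ≐ Poles → Sph P 0
    poles-sphere (f , g) = sph₀ a b (g (inj₁ refl)) (g (inj₂ refl)) a≢b a≁b f

    private
      pole-rim : ∀ {P} → Suspends P → ∀ {x} → Poles x → P ≐ P ↾ x
      pole-rim σ (inj₁ refl) = (λ p → p , proj₁ (proj₂ (σ p))) , proj₁
      pole-rim σ (inj₂ refl) = (λ p → p , proj₂ (proj₂ (σ p))) , proj₁

      poles-edgeless : ∀ {x y} → Poles x → Poles y → ¬ x ~ y
      poles-edgeless = sph₀-edgeless (poles-sphere (id , id))

      to-pole : ∀ {P} → Suspends P → ∀ {x y} → P x → Poles y → x ~ y
      to-pole σ p (inj₁ refl) = ~-sym (proj₁ (proj₂ (σ p)))
      to-pole σ p (inj₂ refl) = ~-sym (proj₂ (proj₂ (σ p)))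

      non-pole : ∀ {P} → Suspends P → ∀ {x} → P x → ¬ Poles x
      non-pole σ p = [ (λ e → proj₁ (proj₁ (σ p)) (sym e)) , (λ e → proj₂ (proj₁ (σ p)) (sym e)) ]′

      tame-suspended : ∀ {P} → Suspends P → Tame P → Tame (P ∪ Poles)
      tame-suspended {P} σ t = tame-resp
        ( (λ { (inj₁ (inj₁ p)) → inj₁ p ; (inj₁ (inj₂ e)) → inj₂ (inj₁ e) ; (inj₂ e) → inj₂ (inj₂ e) })
        , (λ { (inj₁ p) → inj₁ (inj₁ p) ; (inj₂ (inj₁ e)) → inj₁ (inj₂ e) ; (inj₂ (inj₂ e)) → inj₂ e }))
        (tame-add [ (λ p → non-pole σ p (inj₂ refl)) , a≢b ]′
          (tame-resp ( (λ p → inj₁ p , proj₂ (proj₂ (σ p)))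
                     , (λ { (inj₁ p , _) → p ; (inj₂ refl , r) → ⊥-elim (a≁b (~-sym r)) })) t)
          (tame-add (λ p → non-pole σ p (inj₁ refl)) (tame-resp (pole-rim σ (inj₁ refl)) t) t))

    -- The poles belong to the boundary because the rim of a pole is the disk `B ∪ I` itself, not a
    -- sphere. The interior stays as it was, which is what allows a d-transformation to be
    -- suspended.
    suspended-disk : ∀ {B I n} → Suspends (B ∪ I) → Disk B I n → Disk (B ∪ Poles) I (suc n)
    suspended-disk {B} {I} {n} σ d = disk₊ record
      { whole = tame-resp
          ( (λ { (inj₁ (inj₁ p)) → inj₁ (inj₁ p) ; (inj₁ (inj₂ i)) → inj₂ i ; (inj₂ e) → inj₁ (inj₂ e) })
          , (λ { (inj₁ (inj₁ p)) → inj₁ (inj₁ p) ; (inj₂ i) → inj₁ (inj₂ i) ; (inj₁ (inj₂ e)) → inj₂ e }))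
          (tame-suspended σ (disk-tame d))
      ; B-nonempty = a , inj₂ (inj₁ refl)
      ; I-nonempty = I-ne d
      ; disjoint = λ { (inj₁ b) i → disk-disjoint d b i ; (inj₂ e) i → non-pole σ (inj₂ i) e }
      ; B-rim = λ { {x} (inj₁ b) → B-rim′ σ d b ; {x} (inj₂ e) → disk-resp
          ( (λ b → inj₁ b , proj₂ (proj₁ (pole-rim σ e) (inj₁ b)))
          , (λ { (inj₁ b , _) → b ; (inj₂ e′ , r) → ⊥-elim (poles-edgeless e e′ r) }))
          ( (λ i → i , proj₂ (proj₁ (pole-rim σ e) (inj₂ i))) , proj₁) d }
      ; I-rim = I-rim′ σ d
      ; B-sphere = B-sph σ d }
      where
      I-ne : ∀ {B I n} → Disk B I n → ∃ I
      I-ne (disk₀ i _ i∈ _) = i , i∈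
      I-ne (disk₊ d)        = I-nonempty d
      B-rim′ : ∀ {B I n x} → Suspends (B ∪ I) → Disk B I n → B x →
               Disk ((B ∪ Poles) ↾ x) (I ↾ x) n
      B-rim′ σ (disk₀ _ none _ _) b = ⊥-elim (none b)
      B-rim′ σ (disk₊ d) b = disk-resp
        ( (λ { (inj₁ (b , r)) → inj₁ b , r ; (inj₂ e) → inj₂ e , to-pole σ (inj₁ b) e })
        , (λ { (inj₁ b , r) → inj₁ (b , r) ; (inj₂ e , _) → inj₂ e }))
        (id , id)
        (suspended-disk (λ { (inj₁ (b , _)) → σ (inj₁ b) ; (inj₂ (i , _)) → σ (inj₂ i) }) (B-rim d b))
      I-rim′ : ∀ {B I n x} → Suspends (B ∪ I) → Disk B I n → I x →
               Sph (((B ∪ Poles) ∪ I) ↾ x) n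
      I-rim′ σ (disk₀ i none i∈ all) x∈ = poles-sphere
        ( (λ { (inj₁ (inj₁ b) , _) → ⊥-elim (none b) ; (inj₁ (inj₂ e) , _) → e
             ; (inj₂ y∈ , r) → ⊥-elim (~⇒≢ r (trans (sym (all x∈)) (all y∈))) })
        , (λ e → inj₁ (inj₂ e) , to-pole σ (inj₂ x∈) e))
      I-rim′ σ (disk₊ d) x∈ = sph-resp
        ( (λ { (inj₁ (inj₁ b , r)) → inj₁ (inj₁ b) , r ; (inj₁ (inj₂ i , r)) → inj₂ i , r
             ; (inj₂ e) → inj₁ (inj₂ e) , to-pole σ (inj₂ x∈) e })
        , (λ { (inj₁ (inj₁ b) , r) → inj₁ (inj₁ b , r) ; (inj₂ i , r) → inj₁ (inj₂ i , r)
             ; (inj₁ (inj₂ e) , _) → inj₂ e }))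
        (suspended-sphere (λ (p , _) → σ p) (I-rim d x∈))
      B-sph : ∀ {B I n} → Suspends (B ∪ I) → Disk B I n → Sph (B ∪ Poles) n
      B-sph σ (disk₀ _ none _ _) = poles-sphere ([ ⊥-elim ∘ none , id ]′ , inj₂)
      B-sph σ (disk₊ d) = suspended-sphere (σ ∘ inj₁) (B-sphere d)

-- Dimension one: a circle without a point is contractible

module Circles (X : Space) where
  open Space X hiding (V)
  open Geometry X
  open Respect X
  open Tameness X
  open Spheres X

  -- An arc Q from a neighbour of v to its end e is prolonged until it reaches
  -- the other neighbour b of v; then it is all of P ∖ v.
  punctured-circle-tame : ∀ {P v} → Conn P → (∀ {x} → P x → Sph (P ↾ x) 0) → P v → Tame (P ∖ v)
  punctured-circle-tame {P} {v} conn rims v∈ with rims v∈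
  ... | sph₀ a b (a∈ , v~a) (b∈ , v~b) a≢b _ only-ab =
    let y , (y∈ , a~y) , y≢v , only = sph₀-other (rims a∈) (v∈ , ~-sym v~a) in
    grow (length points) points ≤-refl (tame-singleton a)
      (λ { refl → a∈ , ≢-sym (~⇒≢ v~a) }) refl a≢b refl
      (λ { refl n → ⊥-elim (n refl) })
      y∈ a~y y≢v (~⇒≢ a~y)
      (λ p r → [ (λ e → inj₂ (inj₂ (sym e))) , (λ e → inj₁ (sym e)) ]′ (only (p , r)))
      (λ _ → inj₂ (inj₂ (complete _)))
    where
    -- The point `y` is the one beyond the end `e`. All neighbours of the other points of `Q` lie in
    -- `Q` or equal `v`. The list `xs` covers the points not yet placed, and `m` bounds its length
    -- to ensure termination.
    grow : ∀ m (xs : List (V X)) → length xs ≤ m →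
           ∀ {Q : Subspace} {e y} → Tame Q → Q ⊆ P ∖ v → Q a → ¬ Q b → Q e →
           (∀ {x} → Q x → x ≢ e → ∀ {z} → P z → x ~ z → Q z ⊎ z ≡ v) →
           P y → e ~ y → y ≢ v → ¬ Q y →
           (∀ {z} → P z → e ~ z → z ≡ y ⊎ Q z ⊎ z ≡ v) →
           (∀ {z} → P z → z ≡ v ⊎ Q z ⊎ z ∈ᴸ xs) → Tame (P ∖ v)
    grow m xs len {Q} {e} {y} t Q⊆ a∈Q b∉Q e∈Q inner y∈ e~y y≢v y∉Q e-nbrs rest = extend (y ≟ b)
      where
      Q⁺ : Subspace
      Q⁺ = Q ∪ ｛ y ｝
      Q⁺⊆ : Q⁺ ⊆ P ∖ v
      Q⁺⊆ = [ Q⊆ , (λ { refl → y∈ , y≢v }) ]′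
      -- Within `Q` the point `y` is adjacent to `e` only, so it is added along a one-point rim.
      t⁺ : Tame Q⁺
      t⁺ = tame-add y∉Q (tame-resp
        ( (λ { refl → e∈Q , ~-sym e~y }) , (λ (q , r) → sym (last q r)))
        (tame-singleton e)) t
        where
        last : ∀ {x} → Q x → y ~ x → x ≡ e
        last {x} q r with x ≟ e
        ... | yes x≡e = x≡e
        ... | no x≢e  = ⊥-elim ([ y∉Q , y≢v ]′ (inner q x≢e y∈ (~-sym r)))
      inner⁺ : ∀ {x} → Q⁺ x → x ≢ y → ∀ {z} → P z → x ~ z → Q⁺ z ⊎ z ≡ v
      inner⁺ (inj₂ refl) n = ⊥-elim (n refl)
      inner⁺ {x} (inj₁ q) _ z∈ r with x ≟ e
      ... | yes refl = [ (λ e → inj₁ (inj₂ (sym e))) , map⊎ inj₁ id ]′ (e-nbrs z∈ r)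
      ... | no x≢e   = map⊎ inj₁ id (inner q x≢e z∈ r)
      extend : Dec (y ≡ b) → Tame (P ∖ v)
      extend (yes refl) = tame-resp (Q⁺⊆ , λ (p , n) → [ id , (λ e → ⊥-elim (n e)) ]′ (everything p)) t⁺
        where
        b-nbrs : ∀ {z} → P z → b ~ z → Q⁺ z ⊎ z ≡ v
        b-nbrs z∈ r with sph₀-other (rims b∈) (v∈ , ~-sym v~b)
        ... | c , _ , _ , only with only (e-∈ , ~-sym e~y)
          where e-∈ = proj₁ (Q⊆ e∈Q)
        ... | inj₁ v≡e = ⊥-elim (proj₂ (Q⊆ e∈Q) (sym v≡e))
        ... | inj₂ refl = [ (λ e → inj₂ (sym e)) , (λ { refl → inj₁ (inj₁ e∈Q) }) ]′ (only (z∈ , r))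
        -- Now that both neighbours of `v` are in `Q⁺`, the arc together with `v` is closed under
        -- adjacency, hence all of the connected `P`.
        everything : P ⊆ λ z → Q⁺ z ⊎ z ≡ v
        everything = conn-closed {Q = λ z → Q⁺ z ⊎ z ≡ v} conn v∈ (inj₂ refl) λ
          { (inj₂ refl) _ z∈ r → [ (λ { refl → inj₁ (inj₁ a∈Q) }) , (λ e → inj₁ (inj₂ e)) ]′
                                 (only-ab (z∈ , r))
          ; {x} (inj₁ q) _ z∈ r → step q z∈ r (x ≟ b) }
          where
          step : ∀ {x z} → Q⁺ x → P z → x ~ z → Dec (x ≡ b) → Q⁺ z ⊎ z ≡ v
          step q z∈ r (yes refl) = b-nbrs z∈ r
          step q z∈ r (no x≢b)   = inner⁺ q x≢b z∈ r
      extend (no y≢b) with sph₀-other (rims y∈) (proj₁ (Q⊆ e∈Q) , ~-sym e~y)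
      ... | z , (z∈ , y~z) , z≢e , only = shrink m len
        where
        y-in : y ∈ᴸ xs
        y-in = [ (λ e → ⊥-elim (y≢v e)) , [ (λ q → ⊥-elim (y∉Q q)) , id ]′ ]′ (rest y∈)
        ≢y? : Decidable (_≢ y)
        ≢y? x = ¬? (x ≟ y)
        z≢v : z ≢ v
        z≢v refl = [ (λ { refl → y∉Q a∈Q }) , (λ e → y≢b (sym e)) ]′ (only-ab (y∈ , ~-sym y~z))
        z∉ : ¬ Q⁺ z
        z∉ (inj₂ refl) = ~-irrefl y~z
        z∉ (inj₁ q)    = [ y∉Q , y≢v ]′ (inner q z≢e y∈ (~-sym y~z))
        shorter : length (filter ≢y? xs) < length xs
        shorter = filter-notAll ≢y? xs (Any.map (λ e n → n (sym e)) y-in)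
        rest⁺ : ∀ {z} → P z → z ≡ v ⊎ Q⁺ z ⊎ z ∈ᴸ filter ≢y? xs
        rest⁺ {z} p with rest p | z ≟ y
        ... | inj₁ e        | _        = inj₁ e
        ... | inj₂ (inj₁ q) | _        = inj₂ (inj₁ (inj₁ q))
        ... | inj₂ (inj₂ _) | yes refl = inj₂ (inj₁ (inj₂ refl))
        ... | inj₂ (inj₂ i) | no z≢y   = inj₂ (inj₂ (∈-filter⁺ ≢y? i z≢y))
        shrink : ∀ m → length xs ≤ m → Tame (P ∖ v)
        shrink zero    len = ⊥-elim (1+n≰0 (≤-trans shorter len))
          where
          1+n≰0 : ∀ {n} → ¬ suc n ≤ 0
          1+n≰0 ()
        shrink (suc m) len = grow m (filter ≢y? xs) (≤-pred (≤-trans shorter len))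
          t⁺ Q⁺⊆ (inj₁ a∈Q) [ b∉Q , y≢b ]′ (inj₂ refl) inner⁺ z∈ y~z z≢v z∉
          (λ p r → [ (λ { refl → inj₂ (inj₁ (inj₁ e∈Q)) }) , (λ e → inj₁ (sym e)) ]′ (only (p , r)))
          rest⁺

  circle-sphere : ∀ {P} → Man P 0 → Sph P 1
  circle-sphere (conn , rims) =
    let v , v∈ = proj₁ conn in sph₊ conn rims (v , v∈ , punctured-circle-tame conn rims v∈)

-- The exchange of disks with a common boundary

-- An auxiliary apex has to come from outside: the ambient space is enlarged by one point, and
-- subspaces travel there and back along `ι`.
module Lifting (X : Space) {C : Pred (V X) 0ℓ} (C? : Decidable C) where
  private
    X⁺ = cone X C?
    module Y = Geometry X⁺
  open Geometry X
  open Respect X⁺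

  ↑_ : Subspace → Y.Subspace
  (↑ P) (just x) = P x
  (↑ P) nothing  = ⊥

  ι : Correspondence X X⁺
  ι = to-cone X C?

  maps-↑ : ∀ P → Maps ι P (↑ P)
  maps-↑ P = (λ p → _ , refl , p) , λ { {just x} p → x , refl , p }

  ↑-dec : ∀ {P} → Decidable P → Decidable (↑ P)
  ↑-dec P? (just x) = P? x
  ↑-dec P? nothing  = no λ ()

module Exchange (X : Space) where
  open Space X hiding (V)
  open Geometry X
  open Respect X
  open Tameness X
  open Spheres X

  -- The disk B ∪ I meets A ∪ B in B only.
  record Attached (A B I : Subspace) (n : ℕ) : Set where
    constructor attached
    field
      disk  : Disk B I n
      A∩B   : Disjoint A B
      A∩I   : Disjoint A I
      A-I   : Apart A I

  open Attached

  attached-rim : ∀ {A B I n x} → Attached A B I (suc n) → B x → Attached (A ↾ x) (B ↾ x) (I ↾ x) n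
  attached-rim (attached (disk₊ d) A∩B A∩I A-I) b = attached (B-rim d b)
    (λ p q → A∩B (proj₁ p) (proj₁ q)) (λ p q → A∩I (proj₁ p) (proj₁ q))
    (λ p q → A-I (proj₁ p) (proj₁ q))

  attached-∖ : ∀ {A B I n x} → Attached A B I n → Attached (A ∖ x) B I n
  attached-∖ (attached d A∩B A∩I A-I) =
    attached d (A∩B ∘ proj₁) (A∩I ∘ proj₁) (A-I ∘ proj₁)

  -- Cone off B ∪ I ∪ J by a new point w. The rims of the points of I and of J
  -- are then cones with apex w, so I may be deleted and J added.
  exchange-tame : ∀ {A B I J n} → Decidable A → Attached A B I n → Attached A B J n →
                  Tame (A ∪ (B ∪ I)) → Tame (A ∪ (B ∪ J))
  exchange-tame {A} {B} {I} {J} A? α β t =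
    tame-transport (flip ι) (maps-flip {ρ = ι} (maps-↑ (A ∪ (B ∪ J)))) (remove-apex (⇒ absorb-J (⇐ absorb-I (add-apex t))))
    where
    B? = disk-decB (disk α)
    I? = disk-decI (disk α)
    J? = disk-decI (disk β)
    -- A single apex serves both disks. Its rim is `B ∪ I` when it is added and `B ∪ J` when it is
    -- deleted, each contractible as a whole disk.
    C : Subspace
    C = B ∪ (I ∪ J)
    C? : Decidable C
    C? x = B? x ⊎-dec (I? x ⊎-dec J? x)
    open Lifting X C?
    X⁺ = cone X C?
    module Y where
      open Space X⁺ public
      open Geometry X⁺ public
      open Respect X⁺ public
      open Tameness X⁺ public
    P : Y.Subspace
    P = ↑ (A ∪ B) ∪ ｛ nothing ｝
    P? : Decidable P
    P? x = ↑-dec (λ y → A? y ⊎-dec B? y) x ⊎-dec (nothing Y.≟ x)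
    A∩C : ∀ {x} → A x → ¬ C x
    A∩C a = [ A∩B α a , [ A∩I α a , A∩I β a ]′ ]′
    apex-rim : ∀ {K} → Attached A B K _ → K ⊆ C → Y.Tame (↑ (B ∪ K)) → Y.Tame (↑ (A ∪ (B ∪ K)) Y.↾ nothing)
    apex-rim γ K⊆C = Y.tame-resp
      ( (λ { {just x} (inj₁ b) → inj₂ (inj₁ b) , inj₁ b ; {just x} (inj₂ k) → inj₂ (inj₂ k) , K⊆C k })
      , (λ { {just x} (inj₁ a , c) → ⊥-elim (A∩C a c) ; {just x} (inj₂ p , _) → p }))
    regroup : ∀ {K} → ↑ (A ∪ (B ∪ K)) ∪ ｛ nothing ｝ ≐ P ∪ ↑ K
    regroup =
        (λ { {just x} (inj₁ (inj₁ a)) → inj₁ (inj₁ (inj₁ a))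
           ; {just x} (inj₁ (inj₂ (inj₁ b))) → inj₁ (inj₁ (inj₂ b))
           ; {just x} (inj₁ (inj₂ (inj₂ k))) → inj₂ k
           ; {nothing} _ → inj₁ (inj₂ refl) })
      , (λ { {just x} (inj₁ (inj₁ (inj₁ a))) → inj₁ (inj₁ a)
           ; {just x} (inj₁ (inj₁ (inj₂ b))) → inj₁ (inj₂ (inj₁ b))
           ; {just x} (inj₂ k) → inj₁ (inj₂ (inj₂ k))
           ; {nothing} _ → inj₂ refl })
    lifted : ∀ {K} → Attached A B K _ → Y.Tame (↑ (B ∪ K))
    lifted {K} γ = tame-transport ι (maps-↑ (B ∪ K)) (disk-tame (disk γ))
    add-apex : Tame (A ∪ (B ∪ I)) → Y.Tame (P ∪ ↑ I)
    add-apex t = Y.tame-resp regroup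
      (Y.tame-add (λ ()) (apex-rim α (inj₂ ∘ inj₁) (lifted α))
        (tame-transport ι (maps-↑ (A ∪ (B ∪ I))) t))
    remove-apex : Y.Tame (P ∪ ↑ J) → Y.Tame (↑ (A ∪ (B ∪ J)))
    remove-apex t = Y.tame-resp
      ( (λ { {just x} (inj₁ p , _) → p ; {nothing} (_ , n) → ⊥-elim (n refl) })
      , (λ { {just x} p → inj₁ p , λ () }))
      (Y.tame-delete (inj₂ refl)
        (Y.tame-resp ( (λ { {just x} (p , r) → inj₁ p , r })
                     , (λ { {just x} (inj₁ p , r) → p , r ; {nothing} (_ , ()) }))
          (apex-rim β (inj₂ ∘ inj₂) (lifted β)))
        (Y.tame-resp (swap regroup) t))
    absorb : ∀ {K} → Attached A B K _ → Decidable K → K ⊆ C → Y.Tame P ⇔ Y.Tame (P ∪ ↑ K)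
    absorb γ K? K⊆C = Y.tame-absorb P? (↑-dec K?) (inj₂ refl)
      (λ { {just x} (inj₁ (inj₁ a)) k → A∩I γ a k
         ; {just x} (inj₁ (inj₂ b)) k → disk-disjoint (disk γ) b k })
      (λ { {just x} k → K⊆C k })
      (λ { {just x} {nothing} _ _ _ → inj₁ refl
         ; {just x} {just y} k (inj₁ (inj₁ (inj₁ a))) r → ⊥-elim (A-I γ a k (~-sym r))
         ; {just x} {just y} k (inj₁ (inj₁ (inj₂ b))) r → inj₂ (inj₁ b)
         ; {just x} {just y} k (inj₂ k′) r → inj₂ (K⊆C k′) })
    absorb-I = absorb α I? (inj₂ ∘ inj₁)
    absorb-J = absorb β J? (inj₂ ∘ inj₂)

  rim-∪ : ∀ {A B I} x → (A ∪ (B ∪ I)) ↾ x ≐ (A ↾ x) ∪ ((B ↾ x) ∪ (I ↾ x))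
  rim-∪ x = (λ { (inj₁ a , r) → inj₁ (a , r) ; (inj₂ (inj₁ b) , r) → inj₂ (inj₁ (b , r))
               ; (inj₂ (inj₂ i) , r) → inj₂ (inj₂ (i , r)) })
          , (λ { (inj₁ (a , r)) → inj₁ a , r ; (inj₂ (inj₁ (b , r))) → inj₂ (inj₁ b) , r
               ; (inj₂ (inj₂ (i , r))) → inj₂ (inj₂ i) , r })

  -- For connectedness, an old path from a point of `A` is followed until it meets `B`, since it
  -- cannot step from `A` into `I`; from there it continues inside the connected disk `B ∪ J` to a
  -- fixed boundary point `c`. Points of `A` keep their rims, and points of `J` have theirs within
  -- the new disk.
  exchange-manifold : ∀ {A B I J n} → Attached A B I (suc n) → Attached A B J (suc n) →
                      Man (A ∪ (B ∪ I)) n → Man (A ∪ (B ∪ J)) n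
  -- In positive dimension the puncture `u` is taken in `A`, the part outside the disks that both
  -- spheres share; if `A` were empty, the disk `B ∪ I` would be a sphere. Then `exchange-tame`
  -- applies with `A ∖ u` in place of `A`.
  exchange-sphere : ∀ {A B I J n} → Attached A B I n → Attached A B J n →
                    Sph (A ∪ (B ∪ I)) n → Sph (A ∪ (B ∪ J)) n

  exchange-manifold {A} {B} {I} {J} {n} α@(attached (disk₊ d) A∩B A∩I A-I)
                    β@(attached (disk₊ d′) _ A∩J A-J) ((_ , path) , rims) =
      conn-from (inj₂ (inj₁ c∈)) (λ { (inj₁ a) → reach a (path (inj₁ a) (inj₂ (inj₁ c∈)))
                                    ; (inj₂ p) → within p })
    , new-rims
    where
    c = proj₁ (B-nonempty d)
    c∈ = proj₂ (B-nonempty d)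
    within : ∀ {x} → (B ∪ J) x → Path (A ∪ (B ∪ J)) x c
    within p = path-mono inj₂ (proj₂ (conn (whole d′)) p (inj₁ c∈))
    reach : ∀ {x} → A x → Path (A ∪ (B ∪ I)) x c → Path (A ∪ (B ∪ J)) x c
    reach a ε = ⊥-elim (A∩B a c∈)
    reach a ((_ , inj₁ a′ , r) ◅ path)        = (inj₁ a , inj₁ a′ , r) ◅ reach a′ path
    reach a ((_ , inj₂ (inj₁ b) , r) ◅ path) = (inj₁ a , inj₂ (inj₁ b) , r) ◅ within (inj₁ b)
    reach a ((_ , inj₂ (inj₂ i) , r) ◅ path) = ⊥-elim (A-I a i r)
    new-rims : ∀ {x} → (A ∪ (B ∪ J)) x → Sph ((A ∪ (B ∪ J)) ↾ x) n
    new-rims {x} (inj₁ a) = sph-resp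
      ( (λ { (inj₁ a , r) → inj₁ a , r ; (inj₂ (inj₁ b) , r) → inj₂ (inj₁ b) , r
           ; (inj₂ (inj₂ i) , r) → ⊥-elim (A-I a i r) })
      , (λ { (inj₁ a , r) → inj₁ a , r ; (inj₂ (inj₁ b) , r) → inj₂ (inj₁ b) , r
           ; (inj₂ (inj₂ j) , r) → ⊥-elim (A-J a j r) }))
      (rims (inj₁ a))
    new-rims {x} (inj₂ (inj₁ b)) = sph-resp (swap (rim-∪ x))
      (exchange-sphere (attached-rim α b) (attached-rim β b)
        (sph-resp (rim-∪ x) (rims (inj₂ (inj₁ b)))))
    new-rims {x} (inj₂ (inj₂ j)) = sph-resp
      ( (λ (p , r) → inj₂ p , r)
      , (λ { (inj₁ a , r) → ⊥-elim (A-J a j (~-sym r)) ; (inj₂ p , r) → p , r }))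
      (I-rim d′ j)

  exchange-sphere {A} {B} {I} {J} (attached (disk₀ i none i∈ all) _ A∩I _)
      (attached (disk₀ j none′ j∈ all′) _ A∩J A-J) s@(sph₀ _ _ _ _ _ _ _)
    with sph₀-other s (inj₂ (inj₂ i∈))
  ... | a , inj₂ (inj₁ b) , _ , _       = ⊥-elim (none b)
  ... | a , inj₂ (inj₂ i′) , a≢i , _    = ⊥-elim (a≢i (sym (all i′)))
  ... | a , inj₁ a∈ , _ , only = sph₀ a j (inj₁ a∈) (inj₂ (inj₂ j∈))
    (λ { refl → A∩J a∈ j∈ }) (A-J a∈ j∈)
    λ { (inj₁ a′) → [ (λ { refl → ⊥-elim (A∩I a′ i∈) }) , inj₁ ]′ (only (inj₁ a′))
      ; (inj₂ (inj₁ b)) → ⊥-elim (none b)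
      ; (inj₂ (inj₂ j)) → inj₂ (all′ j) }
  exchange-sphere {A} {B} {I} {J} α@(attached d A∩B A∩I _) β@(attached _ _ A∩J _) s@(sph₊ conn rims _)
    with Any.any? A? points
    where
    A? : Decidable A
    A? x = map′ (λ { (inj₁ a , ¬p) → a ; (inj₂ p , ¬p) → ⊥-elim (¬p p) })
      (λ a → inj₁ a , [ A∩B a , A∩I a ]′)
      (sph-dec s x ×-dec ¬? (disk-decB d x ⊎-dec disk-decI d x))
  ... | no none = ⊥-elim (sphere-not-disk d
    (sph-resp ((λ { (inj₁ a) → ⊥-elim (none (Any.map (λ { refl → a }) (complete _))) ; (inj₂ p) → p }) , inj₂) s))
  ... | yes some with Any.satisfied some
  ... | u , u∈ = let conn′ , rims′ = exchange-manifold α β (conn , rims) in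
    sph₊ conn′ rims′ (u , inj₁ u∈ , tame-resp (swap (away A∩J (Attached.A∩B β))) (exchange-tame A∖u? (attached-∖ α) (attached-∖ β)
      (tame-resp (away A∩I A∩B) (punctured-tame s (inj₁ u∈)))))
    where
    A∖u? : Decidable (A ∖ u)
    A∖u? x = map′ (λ { (inj₁ a , ¬p , n) → a , n ; (inj₂ p , ¬p , _) → ⊥-elim (¬p p) })
      (λ (a , n) → inj₁ a , [ A∩B a , A∩I a ]′ , n)
      (sph-dec s x ×-dec (¬? (disk-decB d x ⊎-dec disk-decI d x) ×-dec ¬? (x ≟ u)))
    away : ∀ {K} → Disjoint A K → Disjoint A B → (A ∪ (B ∪ K)) ∖ u ≐ (A ∖ u) ∪ (B ∪ K)
    away A∩K A∩B =
        (λ { (inj₁ a , n) → inj₁ (a , n) ; (inj₂ p , _) → inj₂ p })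
      , (λ { (inj₁ (a , n)) → inj₁ a , n
           ; (inj₂ (inj₁ b)) → inj₂ (inj₁ b) , λ { refl → A∩B u∈ b }
           ; (inj₂ (inj₂ k)) → inj₂ (inj₂ k) , λ { refl → A∩K u∈ k } })

-- Two disks glued along their boundary

module Gluing (X : Space) where
  open Geometry X
  open Spheres X

  -- Capping off B ∪ I by a new point w gives a sphere, in which the disk
  -- B ∪ ｛ w ｝ may be exchanged for B ∪ J.
  glued-sphere : ∀ {B I J n} →
                 Disk B I (suc n) → Disk B J (suc n) → Disjoint I J → Apart I J →
                 Sph (I ∪ (B ∪ J)) (suc n)
  glued-sphere {B} {I} {J} {n} d@(disk₊ d₊) e I∩J I-J =
    sph-transport (flip ι) (maps-flip {ρ = ι} (maps-↑ (I ∪ (B ∪ J))))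
      (Y.sph-resp
        ( (λ { {just x} p → p ; {nothing} (inj₁ ()) ; {nothing} (inj₂ (inj₁ ())) ; {nothing} (inj₂ (inj₂ ())) })
        , (λ { {just x} p → p }))
        (Y.exchange-sphere cap disk capped))
    where
    B? = disk-decB d
    open Lifting X B?
    X⁺ = cone X B?
    module Y where
      open Geometry X⁺ public
      open Respect X⁺ public
      open Spheres X⁺ public
      open Exchange X⁺ public
    ↑d : Y.Disk (↑ B) (↑ I) (suc n)
    ↑d = disk-transport ι (maps-↑ B) (maps-↑ I) d
    ↑-disjoint : ∀ {P Q} → Disjoint P Q → Y.Disjoint (↑ P) (↑ Q)
    ↑-disjoint f {just x} p q = f p q
    capped : Y.Sph (↑ I ∪ (↑ B ∪ ｛ nothing ｝)) (suc n)
    capped = Y.sph-resp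
      ( (λ { (inj₁ (inj₁ b)) → inj₂ (inj₁ b) ; (inj₁ (inj₂ i)) → inj₁ i ; (inj₂ e) → inj₂ (inj₂ e) })
      , (λ { (inj₁ i) → inj₁ (inj₂ i) ; (inj₂ (inj₁ b)) → inj₁ (inj₁ b) ; (inj₂ (inj₂ e)) → inj₂ e }))
      (Y.capped-disk ↑d (λ { (inj₁ ()) ; (inj₂ ()) })
        (λ { {just x} b → b }) (λ { {just x} i b → disk-disjoint d b i }))
    cap : Y.Attached (↑ I) (↑ B) ｛ nothing ｝ (suc n)
    cap = Y.attached
      (Y.cone-disk (sph-transport ι (maps-↑ B) (B-sphere d₊)) (λ ()) (λ { {just x} b → b }))
      (λ {x} → ↑-disjoint {I} {B} (λ i b → disk-disjoint d b i) {x}) (λ { i refl → i })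
      (λ { {just x} i refl b → disk-disjoint d b i })
    disk : Y.Attached (↑ I) (↑ B) (↑ J) (suc n)
    disk = Y.attached (disk-transport ι (maps-↑ B) (maps-↑ J) e)
      (λ {x} → ↑-disjoint {I} {B} (λ i b → disk-disjoint d b i) {x}) (λ {x} → ↑-disjoint {I} {J} I∩J {x})
      (λ { {just x} {just y} i j → I-J i j })

-- Passing between a graph and the subspace that it lists

module _ {X : Space} {P : Pred (V X) 0ℓ} {G : Graph} (L : Listing X P G) where
  open Geometry X

  listing-maps : Maps (listed L) U P
  listing-maps = (λ {i} _ → at L i , refl , at-∈ L i) , (λ p → let i , e = onto L p in i , e , tt)

  listing-maps-at : ∀ {Q} → Q ⊆ P → Maps (listed L) (Q ∘ at L) Q
  listing-maps-at {Q} Q⊆P =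
      (λ {i} q → at L i , refl , q)
    , (λ q → let i , e = onto L (Q⊆P q) in i , e , subst Q (sym e) q)

  Image : Pred (Point G) 0ℓ → Subspace
  Image Q x = ∃[ i ] Q i × at L i ≡ x

  listing-maps-image : ∀ {Q} → Maps (listed L) Q (Image Q)
  listing-maps-image = (λ {i} q → at L i , refl , i , q , refl) , λ (i , q , e) → i , e , q

  listing-induced : ∀ p {Q : Subspace} → Image (Subset._∈ p) ≐ Q → Listing X Q (induced G p)
  listing-induced p e = listing-resp e (listing-∘ L (induced-listing G p))

  listing-≅ : ∀ {H} → H ≅ G → Listing X P H
  listing-≅ φ = listing-resp
    ((λ { (i , _ , refl) → at-∈ L i }) , (λ p → let i , e = onto L p in i , tt , e))
    (listing-∘ L (iso-listing φ))

  listing-select : ∀ {Q} (Q? : Decidable Q) → Q ⊆ P → Listing X Q (induced G (select (Q? ∘ at L)))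
  listing-select {Q} Q? Q⊆P = listing-induced _
    ( (λ { (i , i∈ , refl) → select⁻ (Q? ∘ at L) i∈ })
    , (λ q → let i , e = onto L (Q⊆P q) in i , select⁺ (Q? ∘ at L) (subst Q (sym e) q) , e))

module _ {X : Space} {P : Pred (V X) 0ℓ} {G : Graph} (L : Listing X P G) where
  open Geometry X
  open Spheres X using (disk-decB; disk-disjoint)

  boundary : ∀ {B I n} → Disk B I n → Subset (order G)
  boundary d = select (disk-decB d ∘ at L)

  disk-pull : ∀ {B I n} (d : Disk B I n) → P ≐ B ∪ I →
              Geometry.Disk ⟨ G ⟩ (Subset._∈ boundary d) (Subset._∉ boundary d) n
  disk-pull {B} {I} d (P⊆ , ⊆P) = Respect.disk-resp ⟨ G ⟩
    (select⁺ B? , select⁻ B?)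
    ( (λ i m → disk-disjoint d (select⁻ B? m) i)
    , (λ {x} n → [ (λ b → ⊥-elim (n (select⁺ B? b))) , id ]′ (P⊆ (at-∈ L x))))
    (disk-transport (flip (listed L))
      (maps-flip {ρ = listed L} (listing-maps-at L (⊆P ∘ inj₁)))
      (maps-flip {ρ = listed L} (listing-maps-at L (⊆P ∘ inj₂))) d)
    where
    B? : Decidable (B ∘ at L)
    B? = disk-decB d ∘ at L

  sph-push : ∀ {n} → Geometry.Sph ⟨ G ⟩ U n → Sph P n
  sph-push = sph-transport (listed L) (listing-maps L)

  sph-pull : ∀ {n} → Sph P n → Geometry.Sph ⟨ G ⟩ U n
  sph-pull = sph-transport (flip (listed L)) (maps-flip {ρ = listed L} (listing-maps L))

  disk-push : ∀ {B I n} → Geometry.Disk ⟨ G ⟩ B I n → Disk (Image L B) (Image L I) n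
  disk-push = disk-transport (listed L) (listing-maps-image L) (listing-maps-image L)

  sph₀-≅ : Sph P 0 → G ≅ S⁰
  sph₀-≅ (sph₀ a b a∈ b∈ a≢b a≁b all) = listed-≅ L record
    { at = at′
    ; at-∈ = λ { zero → a∈ ; (suc zero) → b∈ }
    ; onto = λ p → [ (λ e → zero , e) , (λ e → suc zero , e) ]′ (all p)
    ; at-inj = λ { {zero} {zero} _ → refl ; {zero} {suc zero} e → ⊥-elim (a≢b e)
                 ; {suc zero} {zero} e → ⊥-elim (a≢b (sym e)) ; {suc zero} {suc zero} _ → refl }
    ; adj⁺ = λ { {zero} {zero} () ; {zero} {suc zero} (there ())
               ; {suc zero} {zero} () ; {suc zero} {suc zero} (there ()) }
    ; adj⁻ = λ { {zero} {zero} r → ⊥-elim (~-irrefl r) ; {zero} {suc zero} r → ⊥-elim (a≁b r)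
               ; {suc zero} {zero} r → ⊥-elim (a≁b (~-sym r)) ; {suc zero} {suc zero} r → ⊥-elim (~-irrefl r) } }
    where
    open Space X using (~-sym; ~-irrefl)
    at′ : Fin 2 → V X
    at′ zero       = a
    at′ (suc zero) = b

  disk₀-≅ : ∀ {B I} → Disk B I 0 → P ≐ B ∪ I → G ≅ K₁
  disk₀-≅ (disk₀ i none i∈ all) (P⊆ , ⊆P) = listed-≅ L (listing-resp
    ((λ { refl → ⊆P (inj₂ i∈) }) , (λ p → [ (λ b → ⊥-elim (none b)) , all ]′ (P⊆ p)))
    (listing (Tameness.tame-singleton X i)))

  K₁-no-sphere : G ≅ K₁ → ¬ Sph P 0
  K₁-no-sphere φ (sph₀ a b a∈ b∈ a≢b _ _) with onto L a∈ | onto L b∈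
  ... | i , refl | j , refl = a≢b (cong (at L) (at-inj (iso-listing φ) (Fin1 _ _)))
    where
    Fin1 : ∀ (i j : Fin 1) → i ≡ j
    Fin1 zero zero = refl

S⁰-sphere : Geometry.Sph ⟨ S⁰ ⟩ U 0
S⁰-sphere = Geometry.sph₀ zero (suc zero) tt tt (λ ()) (λ { (there ()) })
  λ { {zero} _ → inj₁ refl ; {suc zero} _ → inj₂ refl }

nonZero-point : ∀ {n} → NonZero n → Fin n
nonZero-point {suc n} _ = zero
nonZero-point {zero} record { nonZero = () }

point-nonZero : ∀ {n} → Fin n → NonZero n
point-nonZero {suc n} _ = _

connected⇒conn : ∀ {G} → Connected G → Geometry.Conn ⟨ G ⟩ U
connected⇒conn (nz , path) = (nonZero-point nz , tt) , λ {x} {y} _ _ → Star.map (λ r → tt , tt , r) (path x y)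

conn⇒connected : ∀ {G P} → Geometry.Conn ⟨ G ⟩ P → U ⊆ P → Connected G
conn⇒connected ((x , _) , path) all = point-nonZero x , λ v u →
  Star.map (λ (_ , _ , r) → r) (path (all tt) (all tt))

rim-listing : ∀ {G} v {Q : Pred (Point G) 0ℓ} →
              (Subset._∈ O G v) ≐ Q → Listing ⟨ G ⟩ Q (rim G v)
rim-listing {G} v e = listing-resp e (induced-listing G (O G v))

delete-listing : ∀ {G} v → Listing ⟨ G ⟩ (Geometry._∖_ ⟨ G ⟩ U v) (G - v)
delete-listing {G} v = listing-resp
  ( (λ m → tt , λ { refl → x∈∁p⇒x∉p m (x∈⁅x⁆ v) })
  , (λ (_ , n) → x∉p⇒x∈∁p (λ m → n (x∈⁅y⁆⇒x≡y v m))))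
  (induced-listing G (∁ ⁅ v ⁆))

-- The two halves of a glued graph

-- The glued graph, with its points tagged: those of G on the left, and those
-- of H outside q on the right.
module Glue (G : Graph) (p : Subset (order G)) (H : Graph) (q : Subset (order H))
            (φ : induced G p ≅ induced H q) where

  private
    R : Point G → Point (induced H (∁ q)) → Set
    R x y = ∃[ i ] embed p i ≡ x × Adjacent H (embed q (_≅_.to φ i)) (embed (∁ q) y)

    R? : ∀ x y → Dec (R x y)
    R? x y = any? λ i →
      (embed p i ≟ᶠ x) ×-dec (embed (∁ q) y ∈? O H (embed q (_≅_.to φ i)))

  space : Space
  space = linkedSpace G (induced H (∁ q)) R?

  glue-listing : Listing space U (glue G p H q φ)
  glue-listing = linked-listing G (induced H (∁ q)) R?

  Left : Pred (Point G) 0ℓ → Pred (V space) 0ℓ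
  Left P (inj₁ x) = P x
  Left P (inj₂ y) = ⊥

  Right : Pred (V space) 0ℓ
  Right (inj₁ x) = ⊥
  Right (inj₂ y) = ⊤

  left : Correspondence ⟨ G ⟩ space
  left = record
    { R = λ x y → inj₁ x ≡ y ; functional = λ { refl e → e } ; injective = λ { refl refl → refl }
    ; adj = λ { refl refl r → r } ; adj⁻¹ = λ { refl refl r → r } }

  left-maps : ∀ P → Maps left P (Left P)
  left-maps P = (λ p → _ , refl , p) , λ { {inj₁ x} p → x , refl , p }

  private
    L = induced-listing H (∁ q)

    -- A point of `q` is represented by its counterpart in `p`, any other point of `H` by itself. In
    -- this way all of `H`, and not only its part outside `q`, is found in the glued graph.
    _▷_ : Point H → V space → Set
    h ▷ inj₁ x = ∃[ i ] embed q (_≅_.to φ i) ≡ h × embed p i ≡ x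
    h ▷ inj₂ j = embed (∁ q) j ≡ h

    ∈-or-∉ : ∀ i j → ¬ embed q i ≡ embed (∁ q) j
    ∈-or-∉ i j e = x∈∁p⇒x∉p (embed-∈ (∁ q) j) (subst (Subset._∈ q) e (embed-∈ q i))

  right : Correspondence ⟨ H ⟩ space
  right = record
    { R = _▷_
    ; functional = λ
        { {y = inj₁ _} {inj₁ _} (i , refl , refl) (j , e , refl) →
            cong (inj₁ ∘ embed p) (at-inj (iso-listing φ) (embed-injective q (sym e)))
        ; {y = inj₁ _} {inj₂ j} (i , refl , refl) e → ⊥-elim (∈-or-∉ _ _ (sym e))
        ; {y = inj₂ _} {inj₁ _} refl (j , e , refl) → ⊥-elim (∈-or-∉ _ _ e)
        ; {y = inj₂ _} {inj₂ j} refl e → cong inj₂ (embed-injective (∁ q) (sym e)) }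
    ; injective = λ
        { {y = inj₁ _} (i , refl , refl) (j , refl , e) →
            cong (embed q ∘ _≅_.to φ) (embed-injective p (sym e))
        ; {y = inj₂ _} refl refl → refl }
    ; adj = λ
        { {y = inj₁ _} {inj₁ _} (i , refl , refl) (j , refl , refl) r →
            adj⁺ (induced-listing G p) (adj⁻ (iso-listing φ) (adj⁻ (induced-listing H q) r))
        ; {y = inj₁ _} {inj₂ j} (i , refl , refl) refl r → i , refl , r
        ; {y = inj₂ _} {inj₁ _} refl (j , refl , refl) r → j , refl , O-sym H r
        ; {y = inj₂ _} {inj₂ j} refl refl r → adj⁻ L r }
    ; adj⁻¹ = λ
        { {y = inj₁ _} {inj₁ _} (i , refl , refl) (j , refl , refl) r →
            adj⁺ (induced-listing H q) (adj⁺ (iso-listing φ) (adj⁻ (induced-listing G p) r))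
        ; {y = inj₁ _} {inj₂ j} (i , refl , refl) refl (i′ , e , r) → moved i i′ e r
        ; {y = inj₂ _} {inj₁ _} refl (i , refl , refl) (i′ , e , r) → O-sym H (moved i i′ e r)
        ; {y = inj₂ _} {inj₂ j} refl refl r → adj⁺ L r } }
    where
    moved : ∀ i i′ {y} → embed p i′ ≡ embed p i → Adjacent H (embed q (_≅_.to φ i′)) y →
            Adjacent H (embed q (_≅_.to φ i)) y
    moved i i′ e r = subst (λ k → Adjacent H (embed q (_≅_.to φ k)) _) (embed-injective p e) r

  right-maps-boundary : Maps right (Subset._∈ q) (Left (Subset._∈ p))
  right-maps-boundary =
      (λ h∈ → let j , e = embed-surjective q h∈
                  i , e′ = onto (iso-listing φ) {j} tt
              in inj₁ (embed p i) , (i , trans (cong (embed q) e′) e , refl) , embed-∈ p i)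
    , (λ { {inj₁ x} x∈ → let i , e = embed-surjective p x∈ in
           embed q (_≅_.to φ i) , (i , refl , e) , embed-∈ q _ })

  right-maps-interior : Maps right (Subset._∉ q) Right
  right-maps-interior =
      (λ h∉ → let j , e = embed-surjective (∁ q) (x∉p⇒x∈∁p h∉) in inj₂ j , e , tt)
    , (λ { {inj₂ j} _ → embed (∁ q) j , refl , x∈∁p⇒x∉p (embed-∈ (∁ q) j) })

-- Agreement with the given definitions of spheres, disks and manifolds

open Geometry using (sph₊; disk₀; disk₊)

IsSph : ℕ → Graph → Set
IsSph n G = Geometry.Sph ⟨ G ⟩ U n

IsDsk : ℕ → (D : Graph) → Subset (order D) → Set
IsDsk n D b = Geometry.Disk ⟨ D ⟩ (Subset._∈ b) (Subset._∉ b) n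

IsMan : ℕ → Graph → Set
IsMan n G = Geometry.Man ⟨ G ⟩ U n

subset-cover : ∀ {n} {b : Subset n} → U ≐ (Subset._∈ b) ∪ (Subset._∉ b)
subset-cover {b = b} = (λ {x} _ → cover (x ∈? b)) , _
  where
  cover : ∀ {x} → Dec (x Subset.∈ b) → x Subset.∈ b ⊎ x Subset.∉ b
  cover (yes m) = inj₁ m
  cover (no m)  = inj₂ m

rims-sph : ∀ {n G} → (∀ v → IsSph n (rim G v)) →
           ∀ {x : Point G} → U x → Geometry.Sph ⟨ G ⟩ (Geometry._↾_ ⟨ G ⟩ U x) n
rims-sph rims {x} _ = sph-push (rim-listing x ((λ r → tt , r) , proj₂)) (rims x)

sphere₀⇒sph : ∀ {G} → Is0Sphere G → IsSph 0 G
sphere₀⇒sph φ = sph-pull (iso-listing φ) S⁰-sphere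

sphere₁⇒sph : ∀ {G} → Is1Sphere G → IsSph 1 G
sphere₁⇒sph {G} (connected , rims) = Circles.circle-sphere ⟨ G ⟩
  (connected⇒conn {G} connected , rims-sph (sphere₀⇒sph ∘ rims))

-- Rims are single points on `B` and pairs of points on `I`, so the criterion by end points picks
-- out exactly `B`.
disk₁-boundary : ∀ {D b B I} → Geometry.Disk ⟨ D ⟩ B I 1 → U ≐ B ∪ I →
                 (∀ x → x Subset.∈ b ⇔ Is0Disk (rim D x)) → IsDsk 1 D b
disk₁-boundary {D} {b} {B} {I} d@(disk₊ d₊) (cover , _) is-end =
  Respect.disk-resp ⟨ D ⟩
    ( (λ {x} m → ⇐ (is-end x) (end m))
    , (λ {x} m → [ id , (λ i → ⊥-elim (not-end i (⇒ (is-end x) m))) ]′ (cover tt)))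
    ( (λ {x} i m → not-end i (⇒ (is-end x) m))
    , (λ {x} n → [ (λ m → ⊥-elim (n (⇐ (is-end x) (end m)))) , id ]′ (cover tt)))
    d
  where
  open Geometry ⟨ D ⟩ hiding (sph₊; disk₀; disk₊)
  end : ∀ {x} → B x → Is0Disk (rim D x)
  end {x} m = disk₀-≅ (induced-listing D (O D x)) (B-rim d₊ m)
    ( (λ r → [ (λ b → inj₁ (b , r)) , (λ i → inj₂ (i , r)) ]′ (cover tt)) , [ proj₂ , proj₂ ]′)
  not-end : ∀ {x} → I x → ¬ Is0Disk (rim D x)
  not-end {x} i φ = K₁-no-sphere (induced-listing D (O D x)) φ
    (Respect.sph-resp ⟨ D ⟩ (proj₂ , λ r → cover tt , r) (I-rim d₊ i))

disk₁⇒disk : ∀ {D b} → Is1Disk D b → IsDsk 1 D b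
disk₁⇒disk {D} {b} d = disk₁-boundary
  (disk-transport (flip (listed L))
    (maps-flip {ρ = listed L} (listing-maps-at L (λ (p , r) → p , λ { refl → O-irrefl sphere r })))
    (maps-flip {ρ = listed L} (listing-maps-at L (λ (p , n , _) → p , n)))
    (Spheres.punctured-disk ⟨ sphere ⟩ {U} {deleted} (sphere₁⇒sph is1Sphere) tt))
  ((λ {x} _ → side (at-∈ L x) (at L x ∈? O sphere deleted)) , _)
  isBoundary
  where
  open Is1Disk d
  open Geometry ⟨ sphere ⟩ using (_∖_; _↾_)
  L : Listing ⟨ sphere ⟩ (U ∖ deleted) D
  L = listing-≅ (delete-listing deleted) iso
  side : ∀ {x} → (U ∖ deleted) x → Dec (Adjacent sphere deleted x) →
         ((U ↾ deleted) ∪ (λ y → U y × y ≢ deleted × ¬ Adjacent sphere deleted y)) x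
  side _ (yes r)      = inj₁ (tt , r)
  side (_ , n) (no r) = inj₂ (tt , n , r)

-- The first two arguments are the induction hypotheses. They turn the rim of a boundary point into
-- a disk with some unknown boundary `b′`, which `rim-disk` then identifies with the part of `b` in
-- that rim.
disk-step : ∀ {n D b} → (∀ {G} → IsSphere (suc n) G → IsSph (suc n) G) →
            (∀ {D b} → IsDiskWithBoundary (suc n) D b → IsDsk (suc n) D b) →
            IsDiskWithBoundary (suc (suc n)) D b → IsDsk (suc (suc n)) D b
disk-step {n} {D} {b} sphere⇒ disk⇒ d = disk₊ record
  { whole = tame-resp subset-cover (tame (connected⇒conn {D} connected) (DiskStep.contractible d) (all-listing D))
  ; B-nonempty = boundary-nonempty
  ; I-nonempty = map₂ x∈∁p⇒x∉p interior-nonempty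
  ; disjoint = λ m n → n m
  ; B-rim = λ {x} m → let b′ , d′ = boundary-rim x m in
      rim-disk ∂-sphere interior (λ m n → n m) m
        (disk-push (induced-listing D (O D x)) (disk⇒ d′))
        ( (λ { (inj₁ (i , _ , refl)) → in-rim i ; (inj₂ (i , _ , refl)) → in-rim i })
        , (λ (_ , r) → let i , e = embed-surjective (O D x) r in
             map⊎ (λ m → i , m , e) (λ m → i , m , e) (proj₁ subset-cover {i} tt)))
  ; I-rim = interior
  ; B-sphere = ∂-sphere }
  where
  open DiskStep d
  open Geometry ⟨ D ⟩ hiding (sph₊; disk₀; disk₊)
  open Respect ⟨ D ⟩
  open Spheres ⟨ D ⟩
  ∂-sphere : Sph (Subset._∈ b) (suc n)
  ∂-sphere = sph-push (induced-listing D b) (sphere⇒ boundary-sphere)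
  interior : ∀ {x} → x Subset.∉ b → Sph (((Subset._∈ b) ∪ (Subset._∉ b)) ↾ x) (suc n)
  interior {x} m = sph-push
    (rim-listing x ((λ r → proj₁ subset-cover tt , r) , proj₂))
    (sphere⇒ (interior-rim x (x∉p⇒x∈∁p m)))
  in-rim : ∀ {x} i → (((Subset._∈ b) ∪ (Subset._∉ b)) ↾ x) (embed (O D x) i)
  in-rim {x} i = proj₁ subset-cover tt , embed-∈ (O D x) i

-- From dimension 2 on, the glued graph is split into the interior of `D`, the common boundary and
-- the interior of `C`. Edges between the halves start in the boundary, so `glued-sphere` applies.
sphere⇒sph : ∀ n {G} → IsSphere n G → IsSph n G
disk⇒dsk   : ∀ n {D b} → IsDiskWithBoundary n D b → IsDsk n D b

sphere⇒sph zero       = sphere₀⇒sph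
sphere⇒sph (suc zero) = sphere₁⇒sph
sphere⇒sph (suc (suc n)) {G} s = sph-pull (listing-≅ glue-listing iso)
  (Respect.sph-resp space
    (_ , λ { {inj₁ x} _ → side x (x ∈? ∂D) ; {inj₂ y} _ → inj₂ (inj₂ tt) })
    (Gluing.glued-sphere space
      (disk-transport left (left-maps _) (left-maps _) (disk⇒dsk (suc (suc n)) D-disk))
      (disk-transport right right-maps-boundary right-maps-interior (disk⇒dsk (suc (suc n)) C-disk))
      (λ { {inj₁ x} _ () })
      (λ { {inj₁ x} {inj₂ y} n _ (i , refl , _) → n (embed-∈ ∂D i) })))
  where
  open SphereStep s
  open Glue D ∂D C ∂C ∂D≅∂C
  side : ∀ x → Dec (x Subset.∈ ∂D) →
         (Left (Subset._∉ ∂D) ∪ (Left (Subset._∈ ∂D) ∪ Right)) (inj₁ x)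
  side x (yes m) = inj₂ (inj₁ m)
  side x (no m)  = inj₁ m

disk⇒dsk zero (φ , empty) =
  let L = iso-listing φ ; i , e = onto L {zero} tt in
  Geometry.disk₀ i (λ {x} m → empty (x , m)) (λ m → empty (i , m))
    (λ {x} _ → at-inj L (trans e (only (at L x))))
  where
  only : ∀ (j : Fin 1) → zero ≡ j
  only zero = refl
disk⇒dsk (suc zero) d = disk₁⇒disk d
disk⇒dsk (suc (suc n)) d = disk-step (sphere⇒sph (suc n)) (disk⇒dsk (suc n)) d

manifold⇒man : ∀ n {G} → IsManifold (suc n) G → IsMan n G
manifold⇒man n {G} (connected , rims) = connected⇒conn {G} connected , rims-sph (sphere⇒sph n ∘ rims)

man⇒connected : ∀ {n G} → IsMan n G → Connected G
man⇒connected {G = G} (conn , _) = conn⇒connected {G} {U} conn id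

man-rim : ∀ {n G} → IsMan n G → ∀ v → IsSph n (rim G v)
man-rim (_ , rims) v = sph-pull (rim-listing v ((λ r → tt , r) , proj₂)) (rims tt)

sph⇒man : ∀ {n G} → IsSph (suc n) G → IsMan n G
sph⇒man (sph₊ conn rims _) = conn , rims

sph₀⇒sphere : ∀ {G} → IsSph 0 G → Is0Sphere G
sph₀⇒sphere {G} = sph₀-≅ (all-listing G)

sph₁⇒sphere : ∀ {G} → IsSph 1 G → Is1Sphere G
sph₁⇒sphere {G} s = man⇒connected {G = G} (sph⇒man s) , sph₀⇒sphere ∘ man-rim {G = G} (sph⇒man s)

-- D is the sphere obtained by capping off its boundary, with the cap deleted.
dsk₁⇒disk : ∀ {D b} → IsDsk 1 D b → Is1Disk D b
dsk₁⇒disk {D} {b} d@(disk₊ d₊) = record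
  { sphere     = addPoint D b
  ; is1Sphere  = sph₁⇒sphere (sph-pull (addPoint-listing D b) (Respect.sph-resp X⁺
      (_ , λ { {just x} _ → inj₁ (proj₁ subset-cover {x} tt) ; {nothing} _ → inj₂ refl })
      (Spheres.capped-disk X⁺ (disk-transport ι (maps-↑ _) (maps-↑ _) d)
        [ id , id ]′ (λ { {just x} m → m }) (λ { {just x} n m → n m }))))
  ; deleted    = zero
  ; iso        = listed-≅ (listing-transport ι (maps-↑ U) (all-listing D))
      (listing-resp
        ( (λ { {just x} _ → tt
             ; {nothing} (zero , m , refl) → x∈∁p⇒x∉p m (x∈⁅x⁆ (zero {n = order D})) })
        , (λ { {just x} _ → suc x , x∉p⇒x∈∁p (λ m → 1+x≢0 (x∈⁅y⁆⇒x≡y zero m)) , refl }))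
        (listing-∘ (addPoint-listing D b) (induced-listing (addPoint D b) (∁ ⁅ zero ⁆))))
  ; isBoundary = λ x → mk⇔
      (λ m → disk₀-≅ (induced-listing D (O D x)) (B-rim d₊ m)
        ( (λ r → map⊎ (_, r) (_, r) (proj₁ subset-cover tt)) , [ proj₂ , proj₂ ]′))
      (λ φ → [ id , (λ n → ⊥-elim (K₁-no-sphere (induced-listing D (O D x)) φ
         (Respect.sph-resp ⟨ D ⟩ (proj₂ , λ r → proj₁ subset-cover tt , r) (I-rim d₊ n)))) ]′
         (proj₁ subset-cover tt)) }
  where
  X⁺ = cone ⟨ D ⟩ (_∈? b)
  open Geometry ⟨ D ⟩ hiding (sph₊; disk₀; disk₊)
  open Lifting ⟨ D ⟩ (_∈? b)
  1+x≢0 : ∀ {n} {x : Fin n} → ¬ suc x ≡ zero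
  1+x≢0 ()

sph⇒sphere : ∀ n {G} → IsSph n G → IsSphere n G
dsk⇒disk   : ∀ n {D b} → IsDsk n D b → IsDiskWithBoundary n D b

-- A sphere is glued from the complement of a point v and the cone over the rim of v.
sph⇒sphere zero       = sph₀⇒sphere
sph⇒sphere (suc zero) = sph₁⇒sphere
sph⇒sphere (suc (suc n)) {G} s@(sph₊ ((v , _) , _) rims _) = record
  { D      = G - v
  ; C      = C
  ; ∂D     = ∂D
  ; ∂C     = ∂C
  ; D-disk = dsk⇒disk (suc (suc n)) (disk-pull LD D-disk D-points)
  ; C-disk = dsk⇒disk (suc (suc n)) (disk-pull LC C-disk C-points)
  ; ∂D≅∂C  = φ
  ; iso    = listed-≅ (all-listing G) (listing-transport ρ ρ-maps glue-listing)
  }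
  where
  open Geometry ⟨ G ⟩ hiding (sph₊; disk₀; disk₊)
  open Spheres ⟨ G ⟩
  I J : Subspace
  I y = U y × y ≢ v × ¬ Adjacent G v y
  J = ｛ v ｝
  D-disk : Disk (U ↾ v) I (suc (suc n))
  D-disk = punctured-disk s tt
  C-disk : Disk (U ↾ v) J (suc (suc n))
  C-disk = cone-disk (rims tt) (O-irrefl G ∘ proj₂) proj₂
  LD : Listing ⟨ G ⟩ (U ∖ v) (G - v)
  LD = delete-listing v
  D-points : U ∖ v ≐ (U ↾ v) ∪ I
  D-points = (λ {x} (_ , x≢v) → side x≢v (x ∈? O G v))
           , [ (λ { (_ , r) → tt , λ { refl → O-irrefl G r } }) , (λ (_ , n , _) → tt , n) ]′
    where
    side : ∀ {x} → x ≢ v → Dec (Adjacent G v x) → ((U ↾ v) ∪ I) x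
    side _ (yes r)  = inj₁ (tt , r)
    side n (no ¬r) = inj₂ (tt , n , ¬r)
  C? : Decidable ((U ↾ v) ∪ J)
  C? x = (yes tt ×-dec (x ∈? O G v)) ⊎-dec (v ≟ᶠ x)
  C = induced G (select C?)
  LC : Listing ⟨ G ⟩ ((U ↾ v) ∪ J) C
  LC = listing-select (all-listing G) C? _
  C-points : (U ↾ v) ∪ J ≐ (U ↾ v) ∪ J
  C-points = id , id
  ∂D : Subset (order (G - v))
  ∂D = boundary LD D-disk
  ∂C : Subset (order C)
  ∂C = boundary LC C-disk
  L∂D : Listing ⟨ G ⟩ (U ↾ v) (induced (G - v) ∂D)
  L∂D = listing-select LD (disk-decB D-disk) (proj₂ D-points ∘ inj₁)
  L∂C : Listing ⟨ G ⟩ (U ↾ v) (induced C ∂C)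
  L∂C = listing-select LC (disk-decB C-disk) inj₁
  φ : induced (G - v) ∂D ≅ induced C ∂C
  φ = proj₁ (same-listing L∂D L∂C)
  φ-at : ∀ i → at LC (embed ∂C (_≅_.to φ i)) ≡ at LD (embed ∂D i)
  φ-at = proj₂ (same-listing L∂D L∂C)
  open Glue (G - v) ∂D C ∂C φ
  apex : ∀ j → at LC (embed (∁ ∂C) j) ≡ v
  apex j with at-∈ LC (embed (∁ ∂C) j)
  ... | inj₁ r = ⊥-elim (x∈∁p⇒x∉p (embed-∈ (∁ ∂C) j) (select⁺ (disk-decB C-disk ∘ at LC) r))
  ... | inj₂ e = sym e
  -- The glued graph is mapped back to `G`: the points of `G - v` stay where they are, and the
  -- single interior point of the cone goes to `v`.
  place : V space → Point G
  place (inj₁ x) = at LD x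
  place (inj₂ j) = at LC (embed (∁ ∂C) j)
  place-inj : ∀ {y z} → place y ≡ place z → y ≡ z
  place-inj {inj₁ x} {inj₁ x′} e = cong inj₁ (at-inj LD e)
  place-inj {inj₁ x} {inj₂ j}  e = ⊥-elim (proj₂ (at-∈ LD x) (trans e (apex j)))
  place-inj {inj₂ j} {inj₁ x}  e = ⊥-elim (proj₂ (at-∈ LD x) (trans (sym e) (apex j)))
  place-inj {inj₂ j} {inj₂ k}  e = cong inj₂ (embed-injective (∁ ∂C) (at-inj LC e))
  -- A neighbour of the apex lies in the rim of `v`, hence in the boundary, so the edge arises from
  -- the gluing.
  across : ∀ {x j} → Adjacent G (place (inj₁ x)) (place (inj₂ j)) →
           ∃[ i ] embed ∂D i ≡ x × Adjacent C (embed ∂C (_≅_.to φ i)) (embed (∁ ∂C) j)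
  across {x} {j} r = let i , e = onto L∂D (tt , O-sym G (subst (Adjacent G (at LD x)) (apex j) r)) in
    i , at-inj LD e , adj⁻ LC (subst (λ z → Adjacent G z _) (sym (trans (φ-at i) e)) r)
  across⁻¹ : ∀ {x j} → ∃[ i ] embed ∂D i ≡ x × Adjacent C (embed ∂C (_≅_.to φ i)) (embed (∁ ∂C) j) →
             Adjacent G (place (inj₁ x)) (place (inj₂ j))
  across⁻¹ (i , refl , r) = subst (λ z → Adjacent G z _) (φ-at i) (adj⁺ LC r)
  ρ : Correspondence space ⟨ G ⟩
  ρ = record
    { R = λ y x → place y ≡ x
    ; functional = λ { refl e → e }
    ; injective  = λ { {y} {z} refl e → place-inj (sym e) }
    ; adj = λ { {inj₁ x} {inj₁ x′} refl refl r → adj⁺ LD r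
              ; {inj₁ x} {inj₂ j} refl refl r → across⁻¹ r
              ; {inj₂ j} {inj₁ x} refl refl r → O-sym G (across⁻¹ r)
              ; {inj₂ j} {inj₂ k} refl refl r → adj⁺ LC (adj⁺ (induced-listing C (∁ ∂C)) r) }
    ; adj⁻¹ = λ { {inj₁ x} {inj₁ x′} refl refl r → adj⁻ LD r
                ; {inj₁ x} {inj₂ j} refl refl r → across r
                ; {inj₂ j} {inj₁ x} refl refl r → across (O-sym G r)
                ; {inj₂ j} {inj₂ k} refl refl r → adj⁻ (induced-listing C (∁ ∂C)) (adj⁻ LC r) } }
  ρ-maps : Maps ρ U U
  ρ-maps = (λ {y} _ → place y , refl , tt) , (λ {x} _ → reach x (x ≟ᶠ v))
    where
    reach : ∀ x → Dec (x ≡ v) → ∃[ y ] place y ≡ x × ⊤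
    reach x (no x≢v)   = let i , e = onto LD (tt , x≢v) in inj₁ i , e , tt
    reach x (yes refl) =
      let i , e = onto LC (inj₂ refl)
          j , e′ = embed-surjective (∁ ∂C) (x∉p⇒x∈∁p λ m →
            O-irrefl G (subst (Adjacent G v) e (proj₂ (select⁻ (disk-decB C-disk ∘ at LC) m))))
      in inj₂ j , trans (cong (at LC) e′) e , tt

dsk⇒disk zero {D} {b} (disk₀ i none i∉ all) =
  disk₀-≅ (all-listing D) (Geometry.disk₀ {⟨ D ⟩} i none i∉ all) subset-cover , λ (x , m) → none m
dsk⇒disk (suc zero) d = dsk₁⇒disk d
dsk⇒disk (suc (suc n)) {D} {b} (disk₊ d) = record
  { connected         = conn⇒connected {D} (conn (whole d)) (proj₁ subset-cover)
  ; contractible      = relabel (listed-≅ (listing (whole d))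
      (listing-resp subset-cover (all-listing D))) (contractible (whole d))
  ; boundary-nonempty = B-nonempty d
  ; interior-nonempty = map₂ x∉p⇒x∈∁p (I-nonempty d)
  ; boundary-rim      = λ x m → _ , dsk⇒disk (suc n) (disk-pull (induced-listing D (O D x)) (B-rim d m)
      ( (λ r → map⊎ (_, r) (_, r) (proj₁ subset-cover tt)) , [ proj₂ , proj₂ ]′))
  ; interior-rim      = λ x m → sph⇒sphere (suc n) (sph-pull
      (rim-listing x ((λ r → proj₁ subset-cover tt , r) , proj₂)) (I-rim d (x∈∁p⇒x∉p m)))
  ; boundary-sphere   = sph⇒sphere (suc n) (sph-pull (induced-listing D b) (B-sphere d)) }
  where
  open Geometry ⟨ D ⟩ hiding (sph₊; disk₀; disk₊)

-- Replacing a disk by a point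

-- X with the new edges of joinTo between w and the points of B.
joined : (X : Space) (w : V X) {B : Pred (V X) 0ℓ} → Decidable B → Space
joined X w {B} B? = record
  { V        = V X
  ; _~_      = λ x y → x ~ y ⊎ x ≢ y × (x ≡ w × B y ⊎ y ≡ w × B x)
  ; _≟_      = _≟_
  ; _~?_     = λ x y → (x ~? y) ⊎-dec (¬? (x ≟ y) ×-dec
                 (((x ≟ w) ×-dec B? y) ⊎-dec ((y ≟ w) ×-dec B? x)))
  ; ~-sym    = map⊎ ~-sym λ (n , e) → ≢-sym n , [ inj₂ , inj₁ ]′ e
  ; ~-irrefl = [ ~-irrefl , (λ (n , _) → n refl) ]′
  ; points   = points
  ; complete = complete }
  where open Space X hiding (V)

module _ {X : Space} {G : Graph} (L : Listing X U G) where
  open Space X using (_~_)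
  open Geometry X

  joined-listing : ∀ v {c} {B : Subspace} (B? : Decidable B) → (∀ i → i Subset.∈ c ⇔ B (at L i)) →
                   Listing (joined X (at L v) B?) U (joinTo G v c)
  joined-listing v {c} {B} B? c⇔B = record
    { at     = at L
    ; at-∈   = _
    ; onto   = onto L
    ; at-inj = at-inj L
    ; adj⁺   = λ {x} {y} r → map⊎ (adj⁺ L) (λ (n , e) → (λ e′ → n (at-inj L e′)) ,
        map⊎ (λ (e , m) → cong (at L) e , ⇒ (c⇔B y) m) (λ (e , m) → cong (at L) e , ⇒ (c⇔B x) m) e)
        (⇒ (joinTo-⇔ G v c x y) r)
    ; adj⁻   = λ {x} {y} r → ⇐ (joinTo-⇔ G v c x y) (map⊎ (adj⁻ L) (λ (n , e) → (λ e′ → n (cong (at L) e′)) ,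
        map⊎ (λ (e , m) → at-inj L e , ⇐ (c⇔B y) m) (λ (e , m) → at-inj L e , ⇐ (c⇔B x) m) e) r) }

  replaceDisk-listing : ∀ {p} b v {w} {B I : Subspace} (B? : Decidable B) → at L (embed p v) ≡ w →
    (∀ i → i Subset.∈ image p b ⇔ B (at L i)) → (∀ i → i Subset.∈ image p (∁ b) ⇔ I (at L i)) →
    Listing (joined X w B?) (λ x → ¬ I x ⊎ x ≡ w) (replaceDisk G p b v)
  replaceDisk-listing {p} b v {B = B} {I} B? refl b⇔B b⇔I =
    listing-induced (joined-listing (embed p v) B? b⇔B) (∁ (image p (∁ b)) Subset.∪ ⁅ embed p v ⁆)
      ( (λ { (i , m , refl) → map⊎ (λ m n → x∈∁p⇒x∉p m (⇐ (b⇔I i) n))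
                                   (λ m → cong (at L) (x∈⁅y⁆⇒x≡y _ m)) (x∈p∪q⁻ _ _ m) })
      , (λ {x} q → let i , e = onto L {x} tt in i , x∈p∪q⁺ (member i e q) , e))
    where
    member : ∀ i {x} → at L i ≡ x → ¬ I x ⊎ x ≡ at L (embed p v) →
             i Subset.∈ ∁ (image p (∁ b)) ⊎ i Subset.∈ ⁅ embed p v ⁆
    member i refl (inj₁ n) = inj₁ (x∉p⇒x∈∁p (λ m → n (⇒ (b⇔I i) m)))
    member i refl (inj₂ e) =
      inj₂ (subst (Subset._∈ ⁅ embed p v ⁆) (sym (at-inj L e)) (x∈⁅x⁆ (embed p v)))

-- The data of `disk→point`, singled out because moves of this kind alone, with isomorphisms, lead
-- from a sphere to the minimal one, and because they can be suspended.
Shrink : ℕ → Graph → Graph → Set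
Shrink n N N′ = ∃[ p ] ∃[ b ] IsDiskWithBoundary n (induced N p) b ×
                (∃[ v ] v Subset.∈ ∁ b × N′ ≅ replaceDisk N p b v)

-- Turns a disk found among the subspaces of `X` into a move on graphs; what remains for each use is
-- to list the resulting graph in `joined`.
shrink : ∀ {X G N′ n} {B I : Pred (V X) 0ℓ} w (d : Geometry.Disk X B I n) →
         Listing X U G → I w →
         Listing (joined X w (Spheres.disk-decB X d)) (λ x → ¬ I x ⊎ x ≡ w) N′ → Shrink n G N′
shrink {X} {G} {N′} {n} {B} {I} w d L w∈I L′ =
    p , b , dsk⇒disk n (disk-pull Lp d (id , id)) , v
  , x∉p⇒x∈∁p (λ m → disk-disjoint d (select⁻ (B? ∘ at Lp) m) (subst I (sym v-at) w∈I))
  , listed-≅ L′ (replaceDisk-listing L b v B? v-at in-b in-∁b)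
  where
  open Spheres X
  B? = disk-decB d
  P? : Decidable (B ∪ I)
  P? x = B? x ⊎-dec disk-decI d x
  p : Subset (order G)
  p = select (P? ∘ at L)
  Lp : Listing X (B ∪ I) (induced G p)
  Lp = listing-select L P? _
  b : Subset ∣ p ∣
  b = boundary Lp d
  v : Fin ∣ p ∣
  v = proj₁ (onto Lp (inj₂ w∈I))
  v-at : at L (embed p v) ≡ w
  v-at = proj₂ (onto Lp (inj₂ w∈I))
  in-b : ∀ i → i Subset.∈ image p b ⇔ B (at L i)
  in-b i = mk⇔
    (λ m → let j , j∈ , e = image⁻ p m in subst (B ∘ at L) e (select⁻ (B? ∘ at Lp) j∈))
    (λ m → let j , e = embed-surjective p (select⁺ (P? ∘ at L) (inj₁ m)) in
       subst (Subset._∈ image p b) e (image⁺ p (select⁺ (B? ∘ at Lp) (subst (B ∘ at L) (sym e) m))))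
  in-∁b : ∀ i → i Subset.∈ image p (∁ b) ⇔ I (at L i)
  in-∁b i = mk⇔
    (λ m → let j , j∈ , e = image⁻ p m in subst (I ∘ at L) e
       ([ (λ m → ⊥-elim (x∈∁p⇒x∉p j∈ (select⁺ (B? ∘ at Lp) m))) , id ]′ (at-∈ Lp j)))
    (λ m → let j , e = embed-surjective p (select⁺ (P? ∘ at L) (inj₂ m)) in
       subst (Subset._∈ image p (∁ b)) e (image⁺ p (x∉p⇒x∈∁p (λ m′ →
         disk-disjoint d (select⁻ (B? ∘ at Lp) m′) (subst (I ∘ at L) (sym e) m)))))

-- The join with a 0-sphere, and reduction to the minimal sphere

poleSpace : Graph → Space
poleSpace G = linkedSpace S⁰ G {λ _ _ → ⊤} (λ _ _ → yes tt)

poleSpace-listing : ∀ G → Listing (poleSpace G) U (S⁰ ⊕ G)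
poleSpace-listing G = linked-listing S⁰ G {λ _ _ → ⊤} (λ _ _ → yes tt)

module Suspension (G : Graph) where

  space : Space
  space = poleSpace G

  Equator : Pred (Point G) 0ℓ → Pred (V space) 0ℓ
  Equator P (inj₁ _) = ⊥
  Equator P (inj₂ x) = P x

  Poles : Pred (V space) 0ℓ
  Poles = ｛ inj₁ zero ｝ ∪ ｛ inj₁ (suc zero) ｝

  equator : Correspondence ⟨ G ⟩ space
  equator = record
    { R = λ x y → inj₂ x ≡ y ; functional = λ { refl e → e } ; injective = λ { refl refl → refl }
    ; adj = λ { refl refl r → r } ; adj⁻¹ = λ { refl refl r → r } }

  equator-maps : ∀ P → Maps equator P (Equator P)
  equator-maps P = (λ p → _ , refl , p) , λ { {inj₂ x} p → x , refl , p }

  S⁰-edgeless : ∀ {s t : Point S⁰} → ¬ Adjacent S⁰ s t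
  S⁰-edgeless {s} {t} = Spheres.sph₀-edgeless ⟨ S⁰ ⟩ {U} {s} {t} S⁰-sphere tt tt

  pole : ∀ s → Poles (inj₁ s)
  pole zero       = inj₁ refl
  pole (suc zero) = inj₂ refl

  poles≢ : _≢_ {A = V space} (inj₁ zero) (inj₁ (suc zero))
  poles≢ ()

  suspends : ∀ {P : Pred (V space) 0ℓ} → P ⊆ Equator U →
             Spheres.Suspends space {inj₁ zero} {inj₁ (suc zero)} poles≢
               (S⁰-edgeless {zero} {suc zero}) P
  suspends f {inj₁ _} p = ⊥-elim (f p)
  suspends f {inj₂ _} p = ((λ ()) , (λ ())) , (tt , tt)

  suspension : ∀ {n} → IsSph n G → IsSph (suc n) (S⁰ ⊕ G)
  suspension s = sph-pull (poleSpace-listing G) (Respect.sph-resp space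
    (_ , λ { {inj₁ s} _ → inj₂ (pole s) ; {inj₂ x} _ → inj₁ tt })
    (Spheres.suspended-sphere space poles≢ (S⁰-edgeless {zero} {suc zero}) (suspends id)
      (sph-transport equator (equator-maps U) s)))

minimal-sphere : ∀ n → IsSph n (minimalSphere n)
minimal-sphere zero    = S⁰-sphere
minimal-sphere (suc n) = Suspension.suspension (minimalSphere n) (minimal-sphere n)

module _ {N N′ : Graph} where
  open Suspension N using (Equator; Poles; S⁰-edgeless)

  suspend-≅ : N ≅ N′ → S⁰ ⊕ N ≅ S⁰ ⊕ N′
  suspend-≅ φ = listed-≅ (listing-transport ρ maps (poleSpace-listing N)) (poleSpace-listing N′)
    where
    f : V (poleSpace N) → V (poleSpace N′)
    f (inj₁ s) = inj₁ s
    f (inj₂ x) = inj₂ (_≅_.to φ x)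
    f-inj : ∀ {x y} → f x ≡ f y → x ≡ y
    f-inj {inj₁ _} {inj₁ _} refl = refl
    f-inj {inj₂ _} {inj₂ _} e    = cong inj₂ (at-inj (iso-listing φ) (inj₂-injective e))
    ρ : Correspondence (poleSpace N) (poleSpace N′)
    ρ = record
      { R = λ x y → f x ≡ y
      ; functional = λ { refl e → e }
      ; injective = λ { refl e → f-inj (sym e) }
      ; adj = λ { {inj₁ s} {inj₁ t} refl refl r → r ; {inj₁ s} {inj₂ y} refl refl r → tt
                ; {inj₂ x} {inj₁ t} refl refl r → tt
                ; {inj₂ x} {inj₂ y} refl refl r → adj⁺ (iso-listing φ) r }
      ; adj⁻¹ = λ { {inj₁ s} {inj₁ t} refl refl r → r ; {inj₁ s} {inj₂ y} refl refl r → tt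
                  ; {inj₂ x} {inj₁ t} refl refl r → tt
                  ; {inj₂ x} {inj₂ y} refl refl r → adj⁻ (iso-listing φ) r } }
    maps : Maps ρ U U
    maps = (λ {x} _ → f x , refl , tt)
         , (λ { {inj₁ s} _ → inj₁ s , refl , tt
              ; {inj₂ y} _ → let x , e = onto (iso-listing φ) {y} tt in inj₂ x , cong inj₂ e , tt })

  -- The poles enter the boundary of the disk and its interior is unchanged, so the same points are
  -- deleted. The additional edges, from `w` to the poles, are present in the suspension already.
  suspend-shrink : ∀ {n} → Shrink n N N′ → Shrink (suc n) (S⁰ ⊕ N) (S⁰ ⊕ N′)
  suspend-shrink {n} (p , b , b-disk , v , v∈ , φ) =
    shrink (inj₂ w) d (poleSpace-listing N) w∈I
      (listing-transport ρ maps (poleSpace-listing N′))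
    where
    open Suspension N using (space; equator; equator-maps; poles≢; suspends; pole)
    w : Point N
    w = embed p v
    B I : Pred (Point N) 0ℓ
    B = Image (induced-listing N p) (Subset._∈ b)
    I = Image (induced-listing N p) (Subset._∉ b)
    d₀ : Geometry.Disk ⟨ N ⟩ B I n
    d₀ = disk-push (induced-listing N p) (disk⇒dsk n b-disk)
    d : Geometry.Disk space (Equator B ∪ Poles) (Equator I) (suc n)
    d = Spheres.suspended-disk space poles≢ (S⁰-edgeless {zero} {suc zero})
      (suspends {P = Equator B ∪ Equator I} (λ { {inj₁ _} (inj₁ ()) ; {inj₁ _} (inj₂ ()) ; {inj₂ _} _ → tt }))
      (disk-transport equator (equator-maps B) (equator-maps I) d₀)
    w∈I : I w
    w∈I = v , x∈∁p⇒x∉p v∈ , refl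
    B? : Decidable B
    B? = Spheres.disk-decB ⟨ N ⟩ d₀
    L : Listing (joined ⟨ N ⟩ w B?) (λ x → ¬ I x ⊎ x ≡ w) N′
    L = listing-≅ (replaceDisk-listing (all-listing N) b v B? refl
      (λ i → mk⇔ (image⁻ p) λ { (j , m , refl) → image⁺ p m })
      (λ i → mk⇔ (λ m → let j , j∈ , e = image⁻ p m in j , x∈∁p⇒x∉p j∈ , e)
                 (λ { (j , m , refl) → image⁺ p (x∉p⇒x∈∁p m) }))) φ
    Y = joined space (inj₂ w) (Spheres.disk-decB space d)
    f : V (poleSpace N′) → V Y
    f (inj₁ s) = inj₁ s
    f (inj₂ i) = inj₂ (at L i)
    f-inj : ∀ {x y} → f x ≡ f y → x ≡ y
    f-inj {inj₁ _} {inj₁ _} refl = refl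
    f-inj {inj₂ _} {inj₂ _} e    = cong inj₂ (at-inj L (inj₂-injective e))
    not-pole : ∀ {x} → (Equator B ∪ Poles) (inj₂ x) → B x
    not-pole (inj₁ m) = m
    not-pole (inj₂ (inj₁ ()))
    not-pole (inj₂ (inj₂ ()))
    ρ : Correspondence (poleSpace N′) Y
    ρ = record
      { R = λ x y → f x ≡ y
      ; functional = λ { refl e → e }
      ; injective = λ { refl e → f-inj (sym e) }
      ; adj = λ { {inj₁ s} {inj₁ t} refl refl r → inj₁ r ; {inj₁ s} {inj₂ y} refl refl r → inj₁ tt
                ; {inj₂ x} {inj₁ t} refl refl r → inj₁ tt
                ; {inj₂ x} {inj₂ y} refl refl r → map⊎ id
                    (λ (n , e) → (λ e′ → n (inj₂-injective e′)) ,
                      map⊎ (λ (e , m) → cong inj₂ e , inj₁ m) (λ (e , m) → cong inj₂ e , inj₁ m) e)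
                    (adj⁺ L r) }
      ; adj⁻¹ = λ { {inj₁ s} {inj₁ t} refl refl (inj₁ r) → r
                  ; {inj₁ s} {inj₁ t} refl refl (inj₂ (_ , inj₁ (() , _)))
                  ; {inj₁ s} {inj₁ t} refl refl (inj₂ (_ , inj₂ (() , _)))
                  ; {inj₁ s} {inj₂ y} refl refl r → tt
                  ; {inj₂ x} {inj₁ t} refl refl r → tt
                  ; {inj₂ x} {inj₂ y} refl refl r → adj⁻ L (map⊎ id
                    (λ (n , e) → (λ e′ → n (cong inj₂ e′)) ,
                      map⊎ (λ (e , m) → inj₂-injective e , not-pole m)
                           (λ (e , m) → inj₂-injective e , not-pole m) e) r) } }
    maps : Maps ρ U (λ x → ¬ Equator I x ⊎ x ≡ inj₂ w)
    maps = (λ { {inj₁ s} _ → inj₁ s , refl , inj₁ λ ()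
              ; {inj₂ i} _ → inj₂ (at L i) , refl , map⊎ id (cong inj₂) (at-∈ L i) })
         , (λ { {inj₁ s} _ → inj₁ s , refl , tt
              ; {inj₂ y} m → let i , e = onto L (map⊎ id inj₂-injective m) in
                             inj₂ i , cong inj₂ e , tt })

-- The complement of a point v shrinks to an interior point.
shrink-to-suspension : ∀ {n M} → IsSph n M → (v : Point M) → Shrink n M (S⁰ ⊕ rim M v)
shrink-to-suspension {n} {M} s v =
  shrink u d (all-listing M) u∈I
    (listing-transport ρ maps (poleSpace-listing (rim M v)))
  where
  open Geometry ⟨ M ⟩
  open Spheres ⟨ M ⟩
  I : Subspace
  I y = U y × y ≢ v × ¬ Adjacent M v y
  u = proj₁ (non-neighbour {U} {v} s tt)
  u∈I : I u
  u∈I = proj₂ (non-neighbour {U} {v} s tt)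
  u≢v = proj₁ (proj₂ u∈I)
  v≁u = proj₂ (proj₂ u∈I)
  L = induced-listing M (O M v)
  d : Disk (U ↾ v) I n
  d = punctured-disk s tt
  Y = joined ⟨ M ⟩ u (disk-decB d)
  -- The poles are `v` and the surviving interior point `u`: they are not adjacent, and after the
  -- move both are joined to all of the rim of `v`.
  f : V (poleSpace (rim M v)) → Point M
  f (inj₁ zero)       = v
  f (inj₁ (suc zero)) = u
  f (inj₂ i)          = embed (O M v) i
  v≢ : ∀ i → v ≢ embed (O M v) i
  v≢ i e = O-irrefl M (subst (Adjacent M v) (sym e) (embed-∈ (O M v) i))
  u≢ : ∀ i → u ≢ embed (O M v) i
  u≢ i e = v≁u (subst (Adjacent M v) (sym e) (embed-∈ (O M v) i))
  f-inj : ∀ x y → f x ≡ f y → x ≡ y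
  f-inj (inj₁ zero)       (inj₁ zero)       e = refl
  f-inj (inj₁ zero)       (inj₁ (suc zero)) e = ⊥-elim (u≢v (sym e))
  f-inj (inj₁ zero)       (inj₂ j)          e = ⊥-elim (v≢ j e)
  f-inj (inj₁ (suc zero)) (inj₁ zero)       e = ⊥-elim (u≢v e)
  f-inj (inj₁ (suc zero)) (inj₁ (suc zero)) e = refl
  f-inj (inj₁ (suc zero)) (inj₂ j)          e = ⊥-elim (u≢ j e)
  f-inj (inj₂ i)          (inj₁ zero)       e = ⊥-elim (v≢ i (sym e))
  f-inj (inj₂ i)          (inj₁ (suc zero)) e = ⊥-elim (u≢ i (sym e))
  f-inj (inj₂ i)          (inj₂ j)          e = cong inj₂ (embed-injective (O M v) e)
  module S = Space (poleSpace (rim M v))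
  module Y = Space Y
  v≁u⁺ : ¬ v Y.~ u
  v≁u⁺ (inj₁ r)                            = v≁u r
  v≁u⁺ (inj₂ (_ , inj₁ (e , _)))           = u≢v (sym e)
  v≁u⁺ (inj₂ (_ , inj₂ (_ , (_ , r))))     = O-irrefl M r
  pole-adj : ∀ s i → f (inj₁ s) Y.~ f (inj₂ i)
  pole-adj zero       i = inj₁ (embed-∈ (O M v) i)
  pole-adj (suc zero) i = inj₂ (u≢ i , inj₁ (refl , tt , embed-∈ (O M v) i))
  no-pole-adj : ∀ s t → ¬ f (inj₁ s) Y.~ f (inj₁ t)
  no-pole-adj zero       zero       r = Y.~-irrefl {v} r
  no-pole-adj zero       (suc zero) r = v≁u⁺ r
  no-pole-adj (suc zero) zero       r = v≁u⁺ (Y.~-sym {u} {v} r)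
  no-pole-adj (suc zero) (suc zero) r = Y.~-irrefl {u} r
  f-adj : ∀ x y → x S.~ y → f x Y.~ f y
  f-adj (inj₁ s) (inj₁ t) r = ⊥-elim (Suspension.S⁰-edgeless M {s} {t} r)
  f-adj (inj₁ s) (inj₂ j) r = pole-adj s j
  f-adj (inj₂ i) (inj₁ t) r = Y.~-sym {f (inj₁ t)} {f (inj₂ i)} (pole-adj t i)
  f-adj (inj₂ i) (inj₂ j) r = inj₁ (adj⁺ L r)
  f-adj⁻¹ : ∀ x y → f x Y.~ f y → x S.~ y
  f-adj⁻¹ (inj₁ s) (inj₁ t) r = ⊥-elim (no-pole-adj s t r)
  f-adj⁻¹ (inj₁ s) (inj₂ j) r = tt
  f-adj⁻¹ (inj₂ i) (inj₁ t) r = tt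
  f-adj⁻¹ (inj₂ i) (inj₂ j) (inj₁ r) = adj⁻ L r
  f-adj⁻¹ (inj₂ i) (inj₂ j) (inj₂ (_ , inj₁ (e , _))) = ⊥-elim (u≢ i (sym e))
  f-adj⁻¹ (inj₂ i) (inj₂ j) (inj₂ (_ , inj₂ (e , _))) = ⊥-elim (u≢ j (sym e))
  ρ : Correspondence (poleSpace (rim M v)) Y
  ρ = record
    { R = λ x y → f x ≡ y
    ; functional = λ { refl e → e }
    ; injective = λ { {x} {y} refl e → f-inj x y (sym e) }
    ; adj = λ { {x} {y} refl refl r → f-adj x y r }
    ; adj⁻¹ = λ { {x} {y} refl refl r → f-adj⁻¹ x y r } }
  kept : ∀ x → ¬ I (f x) ⊎ f x ≡ u
  kept (inj₁ zero)       = inj₁ λ (_ , n , _) → n refl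
  kept (inj₁ (suc zero)) = inj₂ refl
  kept (inj₂ i)          = inj₁ λ (_ , _ , n) → n (embed-∈ (O M v) i)
  hit : ∀ x → ¬ I x ⊎ x ≡ u → Dec (x ≡ v) → Dec (Adjacent M v x) → ∃[ y ] f y ≡ x × ⊤
  hit x _        (yes e) _       = inj₁ zero , sym e , tt
  hit x _        _       (yes r) = let i , e = embed-surjective (O M v) r in inj₂ i , e , tt
  hit x (inj₂ e) _       _       = inj₁ (suc zero) , sym e , tt
  hit x (inj₁ n) (no ≢v) (no ≁v) = ⊥-elim (n (tt , ≢v , ≁v))
  maps : Maps ρ U (λ x → ¬ I x ⊎ x ≡ u)
  maps = (λ {x} _ → f x , refl , kept x)
       , (λ {x} m → hit x m (x ≟ᶠ v) (x ∈? O M v))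

-- The d-transformations as exchanges

record Exchanged (n : ℕ) (N N′ : Graph) : Set₁ where
  field
    space   : Space
    A B I J : Pred (V space) 0ℓ
    before  : Exchange.Attached space A B I n
    after   : Exchange.Attached space A B J n
    listsN  : Listing space (A ∪ (B ∪ I)) N
    listsN′ : Listing space (A ∪ (B ∪ J)) N′

exchanged-sym : ∀ {n N N′} → Exchanged n N N′ → Exchanged n N′ N
exchanged-sym e = record
  { before = after ; after = before ; listsN = listsN′ ; listsN′ = listsN }
  where open Exchanged e

exchanged-man : ∀ {n N N′} → Exchanged (suc n) N N′ → IsMan n N → IsMan n N′
exchanged-man e m = man-transport (flip (listed listsN′)) (maps-flip {ρ = listed listsN′} (listing-maps listsN′))
  (Exchange.exchange-manifold space before after (man-transport (listed listsN) (listing-maps listsN) m))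
  where open Exchanged e

exchanged-sph : ∀ {n N N′} → Exchanged n N N′ → IsSph n N → IsSph n N′
exchanged-sph e s = sph-pull listsN′
  (Exchange.exchange-sphere space before after (sph-push listsN s))
  where open Exchanged e

-- Once the rest of `I` is gone, the neighbours of the surviving point `w` are exactly `B`, because
-- no point of `A` touches `I`. So `w` has become the apex of a cone over `B`. In the common space
-- this apex is the new point `nothing`, since `w` itself still belongs to the old interior.
shrink-exchanged : ∀ {n N N′} → IsMan n N → Shrink (suc n) N N′ → Exchanged (suc n) N N′
shrink-exchanged {n} {N} {N′} (_ , rims) (p , b , b-disk , v , v∈ , φ) = record
  { space   = Z
  ; A = ↑ A ; B = ↑ B ; I = ↑ I ; J = ｛ nothing ｝
  ; before  = Exchange.attached (disk-transport ι (maps-↑ B) (maps-↑ I) d)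
      (λ { {just x} → A∩B }) (λ { {just x} → A∩I }) (λ { {just x} {just y} → A-I })
  ; after   = Exchange.attached
      (Spheres.cone-disk Z (sph-transport ι (maps-↑ B) (B-sphere (fields d))) (λ ()) (λ { {just x} m → m }))
      (λ { {just x} → A∩B }) (λ { a refl → a }) (λ { {just x} a refl m → A∩B a m })
  ; listsN  = listing-resp ((λ { {just x} _ → cover (x ∈? p) ; {nothing} () }) , (λ { {just x} _ → tt ; {nothing} (inj₁ ())
      ; {nothing} (inj₂ (inj₁ ())) ; {nothing} (inj₂ (inj₂ ())) }))
      (listing-transport ι (maps-↑ U) (all-listing N))
  ; listsN′ = listing-≅ (listing-transport ρ ρ-maps (replaceDisk-listing (all-listing N) b v B? refl
      (λ i → mk⇔ (image⁻ p) λ { (j , m , refl) → image⁺ p m })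
      (λ i → mk⇔ (λ m → let j , j∈ , e = image⁻ p m in j , x∈∁p⇒x∉p j∈ , e)
                 (λ { (j , m , refl) → image⁺ p (x∉p⇒x∈∁p m) })))) φ
  }
  where
  open Geometry ⟨ N ⟩ using (Subspace; Disk; Disk₊; B-sphere; I-rim)
  open Spheres ⟨ N ⟩ using (disk-decB; disk-disjoint; sub-sphere)
  w : Point N
  w = embed p v
  A B I : Subspace
  A = Subset._∉ p
  B = Image (induced-listing N p) (Subset._∈ b)
  I = Image (induced-listing N p) (Subset._∉ b)
  d : Disk B I (suc n)
  d = disk-push (induced-listing N p) (disk⇒dsk (suc n) b-disk)
  fields : Disk B I (suc n) → Disk₊ B I n
  fields (disk₊ d₊) = d₊
  B? : Decidable B
  B? = disk-decB d
  A∩B : ∀ {x} → A x → ¬ B x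
  A∩B a (i , _ , refl) = a (embed-∈ p i)
  A∩I : ∀ {x} → A x → ¬ I x
  A∩I a (i , _ , refl) = a (embed-∈ p i)
  cover : ∀ {x} → Dec (x Subset.∈ p) → A x ⊎ (B x ⊎ I x)
  cover (no a)  = inj₁ a
  cover (yes m) = let i , e = embed-surjective p m in
    inj₂ (map⊎ (λ m → i , m , e) (λ m → i , m , e) (proj₁ subset-cover {i} tt))
  -- The rim in D of an interior point of the disk D is a subsphere of its rim in N.
  A-I : ∀ {x y} → A x → I y → ¬ Adjacent N x y
  A-I {x} {y} a i r = [ A∩B a , A∩I a ]′
    (proj₁ (sub-sphere (I-rim (fields d) i) (rims {y} tt) (λ (_ , r) → tt , r) {x} (tt , O-sym N r)))
  w∈I : I w
  w∈I = v , x∈∁p⇒x∉p v∈ , refl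
  open Lifting ⟨ N ⟩ B?
  Z : Space
  Z = cone ⟨ N ⟩ B?
  Y : Space
  Y = joined ⟨ N ⟩ w B?
  _▷_ : Point N → Maybe (Point N) → Set
  x ▷ nothing = w ≡ x
  x ▷ just y  = y ≡ x × ¬ I y
  near-w : ∀ {x} → ¬ I x → Adjacent N w x → B x
  near-w {x} n r = [ (λ a → ⊥-elim (A-I a w∈I (O-sym N r))) , [ id , (λ i → ⊥-elim (n i)) ]′ ]′ (cover (x ∈? p))
  open Space Y using () renaming (_~_ to _~ʲ_; ~-sym to ~ʲ-sym; ~-irrefl to ~ʲ-irrefl)
  at-w : ∀ {x} → ¬ I x → w ~ʲ x ⇔ B x
  at-w {x} n = mk⇔
    (λ { (inj₁ r) → near-w n r ; (inj₂ (_ , inj₁ (_ , m))) → m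
       ; (inj₂ (w≢ , inj₂ (e , _))) → ⊥-elim (w≢ (sym e)) })
    (λ m → inj₂ ((λ { e → n (subst I e w∈I) }) , inj₁ (refl , m)))
  off-w : ∀ {x y} → ¬ I x → ¬ I y → x ~ʲ y → Adjacent N x y
  off-w _ _ (inj₁ r)                         = r
  off-w n _ (inj₂ (_ , inj₁ (refl , _)))     = ⊥-elim (n w∈I)
  off-w _ n (inj₂ (_ , inj₂ (refl , _)))     = ⊥-elim (n w∈I)
  ρ : Correspondence Y Z
  ρ = record
    { R = _▷_
    ; functional = λ
        { {y = nothing} {nothing} _ _ → refl
        ; {y = nothing} {just _} refl (refl , n) → ⊥-elim (n w∈I)
        ; {y = just _} {nothing} (refl , n) refl → ⊥-elim (n w∈I)
        ; {y = just _} {just _} (refl , _) (e , _) → cong just (sym e) }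
    ; injective = λ { {y = nothing} refl e → e ; {y = just _} (refl , _) (e , _) → e }
    ; adj = λ
        { {y = nothing} {nothing} refl refl r → ~ʲ-irrefl {w} r
        ; {y = nothing} {just _} refl (refl , n) r → ⇒ (at-w n) r
        ; {x} {y = just _} {nothing} (refl , n) refl r → ⇒ (at-w n) (~ʲ-sym {x} {w} r)
        ; {y = just _} {just _} (refl , n) (refl , n′) r → off-w n n′ r }
    ; adj⁻¹ = λ
        { {y = nothing} {nothing} refl refl ()
        ; {y = nothing} {just _} refl (refl , n) r → ⇐ (at-w n) r
        ; {x} {y = just _} {nothing} (refl , n) refl r → ~ʲ-sym {w} {x} (⇐ (at-w n) r)
        ; {y = just _} {just _} (refl , n) (refl , n′) r → inj₁ r } }
  ρ-maps : Maps ρ (λ x → ¬ I x ⊎ x ≡ w) (↑ A ∪ (↑ B ∪ ｛ nothing ｝))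
  ρ-maps =
      (λ { {x} (inj₁ n) → just x , (refl , n) ,
             [ inj₁ , (λ q → inj₂ (map⊎ id (λ i → ⊥-elim (n i)) q)) ]′ (cover (x ∈? p))
         ; (inj₂ refl) → nothing , refl , inj₂ (inj₂ refl) })
    , (λ { {just x} (inj₁ a) → x , (refl , A∩I a) , inj₁ (A∩I a)
         ; {just x} (inj₂ (inj₁ m)) → x , (refl , disk-disjoint d m) , inj₁ (disk-disjoint d m)
         ; {nothing} _ → w , refl , inj₂ refl })

-- The disk given up is the cone with apex `v` over its rim, which is a sphere since `N` is a
-- manifold; the gluing puts the interior of `D` in the place of `v`.
inflate-exchanged : ∀ {n N N′} → IsMan n N → (v : Point N) (D : Graph) (b : Subset (order D)) →
                    IsDiskWithBoundary (suc n) D b → (φ : rim N v ≅ induced D b) →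
                    N′ ≅ replacePoint N v D b φ → Exchanged (suc n) N N′
inflate-exchanged {n} {N} {N′} (_ , rims) v D b b-disk φ ψ = record
  { space   = space
  ; A = Left A ; B = Left B ; I = Left ｛ v ｝ ; J = Right
  ; before  = Exchange.attached (disk-transport left (left-maps _) (left-maps _)
        (Spheres.cone-disk ⟨ N ⟩ B-sph (O-irrefl N) id))
      (λ {x} → A∩B {x}) (λ { {inj₁ x} (n , _) e → n (sym e) })
      (λ { {inj₁ x} {inj₁ y} (_ , n) refl r → n (O-sym N r) })
  ; after   = Exchange.attached
      (disk-transport right right-maps-boundary right-maps-interior (disk⇒dsk (suc n) b-disk))
      (λ {x} → A∩B {x}) (λ { {inj₁ x} _ () })
      (λ { {inj₁ x} {inj₂ y} (_ , n) _ (i , refl , _) → n (embed-∈ (O N v) i) })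
  ; listsN  = listing-transport left
      ( (λ {x} _ → inj₁ x , refl , side x (x ∈? O N v) (v ≟ᶠ x))
      , (λ { {inj₁ x} _ → x , refl , tt ; {inj₂ y} (inj₁ ()) ; {inj₂ y} (inj₂ (inj₁ ()))
           ; {inj₂ y} (inj₂ (inj₂ ())) }))
      (all-listing N)
  ; listsN′ = listing-≅ (listing-induced glue-listing (∁ ⁅ v ↑ˡ _ ⁆)
      ( (λ { {x} (i , m , e) → kept x (λ e′ → x∈∁p⇒x∉p m
               (subst (Subset._∈ ⁅ v ↑ˡ _ ⁆) (splitAt⁻¹-↑ˡ (trans e e′)) (x∈⁅x⁆ (v ↑ˡ _)))) })
      , (λ {x} q → let i , e = onto glue-listing {x} tt in
           i , x∉p⇒x∈∁p (λ m → present q (trans (sym e)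
             (trans (cong (splitAt (order N)) (x∈⁅y⁆⇒x≡y _ m)) (splitAt-↑ˡ (order N) v _)))) , e))) ψ
  }
  where
  open Glue N (O N v) D b φ
  A B : Pred (Point N) 0ℓ
  A x = x ≢ v × ¬ Adjacent N v x
  B = Adjacent N v
  B-sph : Geometry.Sph ⟨ N ⟩ B n
  B-sph = Respect.sph-resp ⟨ N ⟩ (proj₂ , λ r → tt , r) (rims tt)
  A∩B : ∀ {x} → Left A x → ¬ Left B x
  A∩B {inj₁ x} (_ , n) r = n r
  side : ∀ x → Dec (B x) → Dec (v ≡ x) → (Left A ∪ (Left B ∪ Left ｛ v ｝)) (inj₁ x)
  side x (yes r) _       = inj₂ (inj₁ r)
  side x _       (yes e) = inj₂ (inj₂ e)
  side x (no n)  (no n′) = inj₁ ((λ e → n′ (sym e)) , n)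
  kept : ∀ y → y ≢ inj₁ v → (Left A ∪ (Left B ∪ Right)) y
  kept (inj₁ x) n with x ∈? O N v
  ... | yes r = inj₂ (inj₁ r)
  ... | no ¬r = inj₁ ((λ e → n (cong inj₁ e)) , ¬r)
  kept (inj₂ _) _ = inj₂ (inj₂ tt)
  present : ∀ {y} → (Left A ∪ (Left B ∪ Right)) y → y ≢ inj₁ v
  present (inj₁ (n , _)) refl        = n refl
  present (inj₂ (inj₁ r)) refl       = O-irrefl N r

dtransformation-exchanged : ∀ {n N N′} → IsMan n N → DTransformation (suc n) N N′ →
                            Exchanged (suc n) N N′
dtransformation-exchanged m (disk→point p b d v v∈ φ) = shrink-exchanged m (p , b , d , v , v∈ , φ)
dtransformation-exchanged m (point→disk v D b d φ ψ)  = inflate-exchanged m v D b d φ ψ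

iso-man : ∀ {n N N′} → N ≅ N′ → IsMan n N → IsMan n N′
iso-man φ = man-transport (listed (iso-listing φ)) (listing-maps (iso-listing φ))

Step : ℕ → Graph → Graph → Set
Step n = DTransformation n ∪ᴿ _≅_

step-man : ∀ {n N N′} → Step (suc n) N N′ → IsMan n N → IsMan n N′
step-man (inj₁ t) m = exchanged-man (dtransformation-exchanged m t) m
step-man (inj₂ φ) m = iso-man φ m

-- As a manifold, `N` is related to `N′` by an exchange, and the reversed exchange gives the
-- backward direction.
step-sph : ∀ {n N N′} → Step (suc n) N N′ → IsMan n N → IsSph (suc n) N ⇔ IsSph (suc n) N′
step-sph (inj₁ t) m = let e = dtransformation-exchanged m t in
  mk⇔ (exchanged-sph e) (exchanged-sph (exchanged-sym e))
step-sph (inj₂ φ) m = mk⇔ (sph-push (iso-listing φ)) (sph-pull (iso-listing φ))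

obtainable-sph : ∀ {n M N} → Obtainable (suc n) M N → IsMan n M → IsSph (suc n) M ⇔ IsSph (suc n) N
obtainable-sph ε m = mk⇔ id id
obtainable-sph (s ◅ steps) m =
  let e = step-sph s m ; e′ = obtainable-sph steps (step-man s m)
  in mk⇔ (⇒ e′ ∘ ⇒ e) (⇐ e ∘ ⇐ e′)

shrink-to-minimal : ∀ n {M} → IsSph n M → Star (Shrink n ∪ᴿ _≅_) M (minimalSphere n)
shrink-to-minimal zero s = inj₂ (sph₀⇒sphere s) ◅ ε
shrink-to-minimal (suc n) {M} s@(sph₊ ((v , _) , _) _ _) =
  inj₁ (shrink-to-suspension s v) ◅
  Star.gmap (S⁰ ⊕_) (map⊎ suspend-shrink suspend-≅)
    (shrink-to-minimal n (man-rim {G = M} (sph⇒man s) v))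

-- The two characterisations of spheres among manifolds

-- For the converse, `Equivalent` leaves the direction of the moves open. Moves that start at `M`
-- are read backwards from the minimal sphere, those that start at the minimal sphere forwards.
sphere-equivalent : ∀ {n M} → IsMan n M →
                    IsSph (suc n) M ⇔ Equivalent (suc n) M (minimalSphere (suc n))
sphere-equivalent {n} {M} m = mk⇔
  (λ s → inj₁ (Star.map
    (λ { (inj₁ (p , b , d , v , v∈ , φ)) → inj₁ (disk→point p b d v v∈ φ) ; (inj₂ φ) → inj₂ φ })
    (shrink-to-minimal (suc n) s)))
  [ (λ steps → ⇐ (obtainable-sph steps m) min)
  , (λ steps → ⇒ (obtainable-sph steps (sph⇒man min)) min) ]′
  where
  min = minimal-sphere (suc n)

-- A punctured sphere is a disk by `punctured-disk`. Conversely, the disk `M - v` supplies the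
-- contractible puncture, while connectedness and the rims come from the manifold.
sphere-punctured : ∀ {n M} → IsMan n M →
                   IsSph (suc n) M ⇔ (∃[ v ] IsDisk (suc n) (M - v))
sphere-punctured {n} {M} (conn , rims) = mk⇔ to from
  where
  open Geometry ⟨ M ⟩ using (_↾_)
  to : IsSph (suc n) M → ∃[ v ] IsDisk (suc n) (M - v)
  to s@(sph₊ ((v , _) , _) _ _) = v , _ , dsk⇒disk (suc n)
    (disk-pull (delete-listing {M} v) (Spheres.punctured-disk ⟨ M ⟩ s tt)
      ( (λ {x} (_ , n) → side x n (x ∈? O M v))
      , [ (λ { (_ , r) → tt , λ { refl → O-irrefl M r } }) , (λ (_ , n , _) → tt , n) ]′))
    where
    side : ∀ x → x ≢ v → Dec (Adjacent M v x) → ((U ↾ v) ∪ (λ y → U y × y ≢ v × ¬ Adjacent M v y)) x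
    side _ _ (yes r) = inj₁ (tt , r)
    side _ n (no ¬r) = inj₂ (tt , n , ¬r)
  from : ∃[ v ] IsDisk (suc n) (M - v) → IsSph (suc n) M
  from (v , b , d) with disk⇒dsk (suc n) d
  ... | disk₊ d₊ = sph₊ conn rims (v , tt , tame-transport (listed (delete-listing {M} v))
    ((λ {i} _ → _ , refl , at-∈ (delete-listing {M} v) i)
    , (λ q → let i , e = onto (delete-listing {M} v) q in i , e , proj₁ subset-cover tt))
    (Geometry.whole d₊))

theorem4p1 : (n : ℕ) .{{_ : NonZero n}} →
    (∀ N N′ → IsManifold n N → DTransformation n N N′ → IsManifold n N′)
    × (∀ N N′ → IsSphere n N → DTransformation n N N′ → IsSphere n N′)
    × (∀ M → IsManifold n M → (IsSphere n M ⇔ Equivalent n M (minimalSphere n)))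
    × (∀ M → IsManifold n M → (IsSphere n M ⇔ (∃[ v ] IsDisk n (M - v))))
theorem4p1 (suc n) =
    (λ N N′ m t → man⇒manifold (step-man (inj₁ t) (manifold⇒man n {N} m)))
  , (λ N N′ s t → let s′ = sphere⇒sph (suc n) s in
       sph⇒sphere (suc n) (⇒ (step-sph (inj₁ t) (sph⇒man s′)) s′))
  , (λ M m → via {M} (sphere-equivalent {M = M} (manifold⇒man n {M} m)))
  , (λ M m → via {M} (sphere-punctured {M = M} (manifold⇒man n {M} m)))
  where
  man⇒manifold : ∀ {G} → IsMan n G → IsManifold (suc n) G
  man⇒manifold {G} m = man⇒connected {G = G} m , sph⇒sphere n ∘ man-rim {G = G} m
  via : ∀ {M} {Q : Set} → IsSph (suc n) M ⇔ Q → IsSphere (suc n) M ⇔ Q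
  via e = mk⇔ (⇒ e ∘ sphere⇒sph (suc n)) (sph⇒sphere (suc n) ∘ ⇐ e)
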